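{- Let $\mathscr{F}$ be the smallest family of trees that contains the four trees $P_2$, $P_3$, $P_4$ and $K_{1,3}$ and is closed under the following three operations, in each of which $T_1,\dots,T_p$ are vertex-disjoint trees in $\mathscr{F} \cap \mathscr{T}_{min}$, $S_i$ is a minimum RED:LD set of $T_i$, $S = \bigcup_i S_i$, and $w$ is a new vertex: (a) ($p=2$) if $|V(T_1)| \equiv |V(T_2)| \equiv 2 \pmod 3$, add $w$ and edges $ww_1, ww_2$ with $w_1 \in S_1$, $w_2 \in S_2$; (b) ($p=2$) if $|V(T_1)| \equiv 0$ and $|V(T_2)| \equiv 2 \pmod 3$, add $w$ and edges $ww_1, ww_2$ with $w_1 \in S_1$, $w_2 \in S_2$; (c) if $(|V(T_1)|,\dots,|V(T_p)|) \bmod 3$ equals $(0,0)$, $(1,2)$ or $(2,2,2)$, add $w$ adjacent to exactly one vertex of each $T_i$, chosen so that $|N(w) \cap S| \ge 2$. Then $\mathscr{F} = \mathscr{T}_{min}$.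
   Context: $N(v)$ denotes the open neighborhood of $v$. A set $S \subseteq V(G)$ is a locating-dominating (LD) set if for all $u,v \in V(G)-S$: $N(v)\cap S \neq \varnothing$, and if $u \ne v$ then $N(v) \cap S \neq N(u) \cap S$. A RED:LD set is an LD set $S$ such that $S-\{v\}$ is an LD set for every $v \in S$; a minimum RED:LD set is one of minimum cardinality, and $\textrm{RED:LD}(G)$ is that cardinality. $\mathscr{T}_{min}$ is the family of all trees $T$ of order $n \ge 2$ with $\textrm{RED:LD}(T) = \lceil (2n+2)/3 \rceil$. $P_k$ is the path on $k$ vertices and $K_{1,3}$ the star with three leaves. -}

module Defs where

open import Data.Nat using (ℕ; zero; suc; _+_; _*_; _≤_)
open import Data.Nat.DivMod using (_/_; _%_)
open import Data.Bool using (Bool; true; false; _∨_)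
open import Data.Fin using (Fin; zero; suc; toℕ; splitAt; _≟_)
open import Data.Fin.Subset using (Subset; _∈_; _∉_; _∩_; _-_; ∣_∣)
open import Data.Vec using (tabulate; _++_)
open import Data.List using (List; []; _∷_; _∷ʳ_; length)
open import Data.List.Relation.Unary.Unique.Propositional using (Unique)
open import Data.Product using (Σ; ∃; _×_; _,_)
open import Data.Sum using ([_,_])
open import Data.Unit using (⊤)
open import Relation.Nullary using (¬_; ⌊_⌋)
open import Relation.Binary.PropositionalEquality using (_≡_; _≢_)
open import Function.Bundles using (_↔_; Inverse)

Graph : ℕ → Set
Graph n = Fin n → Fin n → Bool

module _ {n : ℕ} (G : Graph n) where

  Adj : Fin n → Fin n → Set
  Adj u v = G u v ≡ true

  IsSimple : Set
  IsSimple = (∀ u v → G u v ≡ G v u) × (∀ v → G v v ≡ false)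

  data Walk : Fin n → Fin n → Set where
    []  : ∀ {u} → Walk u u
    _∷_ : ∀ {u v w} → Adj u v → Walk v w → Walk u w

  Connected : Set
  Connected = ∀ u v → Walk u v

  data Chain : List (Fin n) → Set where
    nil  : Chain []
    one  : ∀ {x} → Chain (x ∷ [])
    cons : ∀ {x y l} → Adj x y → Chain (y ∷ l) → Chain (x ∷ y ∷ l)

  HasCycle : Set
  HasCycle = Σ (Fin n) λ x → Σ (List (Fin n)) λ l →
    Unique (x ∷ l) × 2 ≤ length l × Chain ((x ∷ l) ∷ʳ x)

  IsTree : Set
  IsTree = IsSimple × Connected × ¬ HasCycle

  IsLD : Subset n → Set
  IsLD S =
    (∀ v → v ∉ S → ∃ λ s → s ∈ S × Adj v s) ×
    (∀ u v → u ∉ S → v ∉ S → u ≢ v →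
       ¬ (∀ s → s ∈ S → (Adj u s → Adj v s) × (Adj v s → Adj u s)))

  IsREDLD : Subset n → Set
  IsREDLD S = IsLD S × (∀ v → v ∈ S → IsLD (S - v))

  IsMinREDLD : Subset n → Set
  IsMinREDLD S = IsREDLD S × (∀ S′ → IsREDLD S′ → ∣ S ∣ ≤ ∣ S′ ∣)

⌈_/3⌉ : ℕ → ℕ
⌈ m /3⌉ = (m + 2) / 3

TMin : (n : ℕ) → Graph n → Set
TMin n G = IsTree G × 2 ≤ n ×
  Σ (Subset n) λ S → IsMinREDLD G S × ∣ S ∣ ≡ ⌈ 2 * n + 2 /3⌉

Iso : {n : ℕ} → Graph n → Graph n → Set
Iso {n} G H = Σ (Fin n ↔ Fin n) λ f → ∀ u v → G u v ≡ H (Inverse.to f u) (Inverse.to f v)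

_⊕_ : {m k : ℕ} → Graph m → Graph k → Graph (m + k)
_⊕_ {m} G H i j with splitAt m i | splitAt m j
... | Data.Sum.inj₁ a | Data.Sum.inj₁ b = G a b
... | Data.Sum.inj₂ a | Data.Sum.inj₂ b = H a b
... | _ | _ = false

addVertex : {n : ℕ} → Graph n → (Fin n → Bool) → Graph (suc n)
addVertex G N zero    zero    = false
addVertex G N zero    (suc j) = N j
addVertex G N (suc i) zero    = N i
addVertex G N (suc i) (suc j) = G i j

single : {n : ℕ} → Fin n → Fin n → Bool
single a x = ⌊ x ≟ a ⌋

_⊎ᵇ_ : {m k : ℕ} → (Fin m → Bool) → (Fin k → Bool) → Fin (m + k) → Bool
_⊎ᵇ_ {m} f g x = [ f , g ] (splitAt m x)

P2 : Graph 2
P2 zero (suc zero) = true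
P2 (suc zero) zero = true
P2 _ _ = false

P3 : Graph 3
P3 u v = ⌊ Data.Nat._≟_ (suc (toℕ u)) (toℕ v) ⌋ ∨ ⌊ Data.Nat._≟_ (suc (toℕ v)) (toℕ u) ⌋

P4 : Graph 4
P4 u v = ⌊ Data.Nat._≟_ (suc (toℕ u)) (toℕ v) ⌋ ∨ ⌊ Data.Nat._≟_ (suc (toℕ v)) (toℕ u) ⌋

K13 : Graph 4
K13 zero zero = false
K13 zero (suc _) = true
K13 (suc _) zero = true
K13 (suc _) (suc _) = false

data 𝓕 : (n : ℕ) → Graph n → Set where
  base-P2  : 𝓕 2 P2
  base-P3  : 𝓕 3 P3
  base-P4  : 𝓕 4 P4
  base-K13 : 𝓕 4 K13
  iso : ∀ {n} {G H : Graph n} → 𝓕 n G → Iso G H → 𝓕 n H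
  op-a : ∀ {n₁ n₂} {T₁ : Graph n₁} {T₂ : Graph n₂} →
    𝓕 n₁ T₁ → TMin n₁ T₁ → 𝓕 n₂ T₂ → TMin n₂ T₂ →
    n₁ % 3 ≡ 2 → n₂ % 3 ≡ 2 →
    (S₁ : Subset n₁) (S₂ : Subset n₂) → IsMinREDLD T₁ S₁ → IsMinREDLD T₂ S₂ →
    (w₁ : Fin n₁) (w₂ : Fin n₂) → w₁ ∈ S₁ → w₂ ∈ S₂ →
    𝓕 (suc (n₁ + n₂)) (addVertex (T₁ ⊕ T₂) (single w₁ ⊎ᵇ single w₂))
  op-b : ∀ {n₁ n₂} {T₁ : Graph n₁} {T₂ : Graph n₂} →
    𝓕 n₁ T₁ → TMin n₁ T₁ → 𝓕 n₂ T₂ → TMin n₂ T₂ →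
    n₁ % 3 ≡ 0 → n₂ % 3 ≡ 2 →
    (S₁ : Subset n₁) (S₂ : Subset n₂) → IsMinREDLD T₁ S₁ → IsMinREDLD T₂ S₂ →
    (w₁ : Fin n₁) (w₂ : Fin n₂) → w₁ ∈ S₁ → w₂ ∈ S₂ →
    𝓕 (suc (n₁ + n₂)) (addVertex (T₁ ⊕ T₂) (single w₁ ⊎ᵇ single w₂))
  op-c2 : ∀ {n₁ n₂} {T₁ : Graph n₁} {T₂ : Graph n₂} →
    𝓕 n₁ T₁ → TMin n₁ T₁ → 𝓕 n₂ T₂ → TMin n₂ T₂ →
    (n₁ % 3 ≡ 0 × n₂ % 3 ≡ 0) Data.Sum.⊎ (n₁ % 3 ≡ 1 × n₂ % 3 ≡ 2) →
    (S₁ : Subset n₁) (S₂ : Subset n₂) → IsMinREDLD T₁ S₁ → IsMinREDLD T₂ S₂ →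
    (x₁ : Fin n₁) (x₂ : Fin n₂) →
    2 ≤ ∣ tabulate (single x₁ ⊎ᵇ single x₂) ∩ (S₁ ++ S₂) ∣ →
    𝓕 (suc (n₁ + n₂)) (addVertex (T₁ ⊕ T₂) (single x₁ ⊎ᵇ single x₂))
  op-c3 : ∀ {n₁ n₂ n₃} {T₁ : Graph n₁} {T₂ : Graph n₂} {T₃ : Graph n₃} →
    𝓕 n₁ T₁ → TMin n₁ T₁ → 𝓕 n₂ T₂ → TMin n₂ T₂ → 𝓕 n₃ T₃ → TMin n₃ T₃ →
    n₁ % 3 ≡ 2 → n₂ % 3 ≡ 2 → n₃ % 3 ≡ 2 →
    (S₁ : Subset n₁) (S₂ : Subset n₂) (S₃ : Subset n₃) →
    IsMinREDLD T₁ S₁ → IsMinREDLD T₂ S₂ → IsMinREDLD T₃ S₃ →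
    (x₁ : Fin n₁) (x₂ : Fin n₂) (x₃ : Fin n₃) →
    2 ≤ ∣ tabulate ((single x₁ ⊎ᵇ single x₂) ⊎ᵇ single x₃) ∩ ((S₁ ++ S₂) ++ S₃) ∣ →
    𝓕 (suc ((n₁ + n₂) + n₃)) (addVertex ((T₁ ⊕ T₂) ⊕ T₃) ((single x₁ ⊎ᵇ single x₂) ⊎ᵇ single x₃))

{-# OPTIONS --safe #-}

-- In a tree, S is a RED:LD set iff every vertex of S has a neighbour in S and every other
-- vertex has two of them. If S is not the whole vertex set, delete some w ∉ S: each of the
-- d ≥ 2 components Tᵢ of T − w inherits the RED:LD set S ∩ Tᵢ, since w ∉ S dominates nothing.
-- By induction 3|S ∩ Tᵢ| = 2|Tᵢ| + 2 + rᵢ with rᵢ ≥ 0, and summing up gives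
-- 3|S| = 2n + 2 + r with r = Σ rᵢ + 2(d − 2). Hence the bound (2n + 2)/3 ≤ |S|, and S attains
-- its ceiling iff r ≤ 2, the residue of n modulo 3 being 2, 0, 1 for r = 0, 1, 2.
-- So at optimality d = 2 with r₁ + r₂ ≤ 2, or d = 3 with all rᵢ = 0: these are the operations.
-- If S is everything, optimality forces n ≤ 4, which leaves the four base trees.
module Submission where

open import Defs
open import Data.Bool as Bool using (Bool; true; false; _∧_; not; if_then_else_)
open import Data.Bool.Properties using (¬-not; ∧-identityʳ; ∧-conicalˡ; ∧-conicalʳ)
open import Data.Empty using (⊥)
open import Data.Fin using (Fin; zero; suc; _↑ˡ_; _↑ʳ_; splitAt; _≟_)
open import Data.Fin.Patterns using (0F; 1F; 2F; 3F)
open import Data.Fin.Permutation using (lift₀; transpose; ↔⇒≡) renaming (id to idₚ)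
open import Data.Fin.Properties
  using (any?; all?; injective⇒≤; suc-injective; ↑ˡ-injective; ↑ʳ-injective; splitAt-↑ˡ; splitAt-↑ʳ; join-splitAt)
open import Data.Fin.Subset using (Subset; ∣_∣; _∈_; _∉_; _∩_; _-_; ⊤)
open import Data.Fin.Subset.Properties using (_∈?_; x∈p∧x≢y⇒x∈p-y; p─q⊆p; ∣⊤∣≡n)
open import Data.List using (List; []; _∷_; _∷ʳ_; length)
import Data.List.Membership.DecPropositional as DecMembership
open import Data.List.Membership.Propositional using () renaming (_∈_ to _∈ₗ_)
open import Data.List.Relation.Unary.All as All using (All; []; _∷_)
open import Data.List.Relation.Unary.All.Properties using (¬Any⇒All¬)
open import Data.List.Relation.Unary.Any using (here; there)
open import Data.List.Relation.Unary.Unique.Propositional using (Unique; []; _∷_)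
open import Data.Nat using (ℕ; zero; suc; _+_; _*_; _≤_; _<_; z≤n; s≤s; s≤s⁻¹; _≤?_)
open import Data.Nat.DivMod using (_%_; m≡m%n+[m/n]*n; m%n<n; m/n*n≤m; [m+kn]%n≡m%n)
open import Data.Nat.Induction using (<-rec)
open import Data.Nat.Properties hiding (_≟_; suc-injective)
open import Data.Nat.Tactic.RingSolver using (solve-∀)
open import Data.Product using (Σ; ∃; ∃₂; _×_; _,_; proj₁; proj₂)
open import Data.Sum using (_⊎_; inj₁; inj₂; [_,_]; [_,_]′; swap)
open import Data.Vec using ([]; _∷_; there; lookup; tabulate; _++_)
open import Data.Vec.Properties
  using ([]=⇒lookup; lookup⇒[]=; lookup-++ˡ; lookup-++ʳ; lookup-zipWith; lookup∘tabulate; lookup-replicate)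
open import Function using (_∘_; const; _↔_; mk⤖; Inverse)
open import Function.Properties.Bijection using (⤖⇒↔)
open import Function.Properties.Inverse using (↔-sym; ↔-trans)
open import Relation.Binary.Construct.Closure.ReflexiveTransitive as Star using (Star; ε; _◅_; _◅◅_)
open import Relation.Binary.PropositionalEquality hiding ([_])
open import Relation.Nullary using (¬_; yes; no; does; contradiction; ⌊_⌋)
open import Relation.Nullary.Decidable using (True; toWitness; _×-dec_; ¬?)
open import Algebra.Properties.Semiring.Sum +-*-semiring
  using (sum; sum-cong-≗; ∑-distrib-+; ∑-comm; sum-permute; *-distribˡ-sum)

-- The count closes because w ∉ S takes 2 from 2n while each branch brings its own constant 2: the
-- sum of all 2|Tᵢ| + 2 is 2(n - 1) + 2d. This identity serves both for joining trees at a new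
-- vertex and for cutting a tree apart. Minimality does not visibly pass from S to its parts, and a
-- tree can have many minimum sets. The induction therefore concerns a tree together with a set
-- satisfying 3|S| ≤ 2n + 4 (`Tight`), a condition that passes to the parts by arithmetic. Only one
-- multiple of 3 lies between 2n + 2 and 2n + 4, so such a set is automatically minimum and has the
-- size that `TMin` demands. The other obstacle is concrete: trees live on `Fin n`, so cutting at w
-- means renumbering every component, and the pieces fit together again only up to isomorphism.
-- Cycles given as lists are awkward for both directions; acyclicity is replaced by `Separated`, a
-- statement about walks avoiding a vertex.

private variable
  m n k n₁ n₂ n₃ : ℕ
  T₁ : Graph n₁
  T₂ : Graph n₂
  T₃ : Graph n₃
  S₁ : Subset n₁
  S₂ : Subset n₂
  S₃ : Subset n₃

-- Counting in finite sets

⟦_⟧ : Bool → ℕ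
⟦ b ⟧ = if b then 1 else 0

-- Inside the proof sets are mostly Boolean predicates: restricting one to a renumbered subtree is
-- then composition with the embedding.
# : (Fin n → Bool) → ℕ
# s = sum (λ v → ⟦ s v ⟧)

#-cong : {s t : Fin n → Bool} → (∀ v → s v ≡ t v) → # s ≡ # t
#-cong s≗t = sum-cong-≗ (λ v → cong ⟦_⟧ (s≗t v))

∣p∣≡#lookup : (p : Subset n) → ∣ p ∣ ≡ # (lookup p)
∣p∣≡#lookup []          = refl
∣p∣≡#lookup (true  ∷ p) = cong suc (∣p∣≡#lookup p)
∣p∣≡#lookup (false ∷ p) = ∣p∣≡#lookup p

#-true : ∀ n → # {n} (const true) ≡ n
#-true zero    = refl
#-true (suc n) = cong suc (#-true n)

sum-mono-≤ : {f g : Fin n → ℕ} → (∀ v → f v ≤ g v) → sum f ≤ sum g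
sum-mono-≤ {zero}  f≤g = z≤n
sum-mono-≤ {suc n} f≤g = +-mono-≤ (f≤g zero) (sum-mono-≤ (f≤g ∘ suc))

sum-0 : ∀ n → sum {n} (λ _ → 0) ≡ 0
sum-0 zero    = refl
sum-0 (suc n) = sum-0 n

infix 7 _==_

_==_ : Fin n → Fin n → Bool
u == v = does (u ≟ v)

==-refl : (v : Fin n) → (v == v) ≡ true
==-refl zero    = refl
==-refl (suc v) = ==-refl v

==⇒≡ : {u v : Fin n} → (u == v) ≡ true → u ≡ v
==⇒≡ {u = u} {v} _ with yes u≡v ← u ≟ v = u≡v

≢⇒== : {u v : Fin n} → u ≢ v → (u == v) ≡ false
≢⇒== {u = u} {v} u≢v with u ≟ v
... | yes u≡v = contradiction u≡v u≢v
... | no  _   = refl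

infixl 6 _∖_

_∖_ : (Fin n → Bool) → Fin n → Fin n → Bool
(s ∖ a) v = s v ∧ not (v == a)

#-∖ : (s : Fin n → Bool) (a : Fin n) → s a ≡ true → # s ≡ suc (# (s ∖ a))
#-∖ s zero    sa rewrite sa = cong suc (#-cong (λ v → sym (∧-identityʳ (s (suc v)))))
#-∖ s (suc a) sa rewrite #-∖ (s ∘ suc) a sa with s zero
... | true  = refl
... | false = refl

∖-member : {s : Fin n → Bool} {a v : Fin n} → s v ≡ true → v ≢ a → (s ∖ a) v ≡ true
∖-member sv v≢a rewrite sv | ≢⇒== v≢a = refl

length≤# : {s : Fin n → Bool} {l : List (Fin n)} →
  Unique l → All (λ v → s v ≡ true) l → length l ≤ # s
length≤# []          []        = z≤n
length≤# {s = s} {a ∷ l} (a∉l ∷ u) (sa ∷ sl) rewrite #-∖ s a sa =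
  s≤s (length≤# u (All.zipWith (λ (a≢v , sv) → ∖-member {s = s} sv (≢-sym a≢v)) (a∉l , sl)))

0<#⇒member : (s : Fin n → Bool) → 1 ≤ # s → ∃ λ v → s v ≡ true
0<#⇒member {suc n} s 1≤ with s zero in eq
... | true  = zero , eq
... | false = let v , sv = 0<#⇒member (s ∘ suc) 1≤ in suc v , sv

1<#⇒members : (s : Fin n → Bool) → 2 ≤ # s → ∃₂ λ u v → u ≢ v × s u ≡ true × s v ≡ true
1<#⇒members s 2≤ with u , su ← 0<#⇒member s (≤-trans (s≤s z≤n) 2≤)
  with v , s∖uv ← 0<#⇒member (s ∖ u) (s≤s⁻¹ (subst (2 ≤_) (#-∖ s u su) 2≤))
  with s v in sv | v ≟ u
... | true | no v≢u = u , v , ≢-sym v≢u , su , sv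

sum-indicator : (a : Fin n) (b : Bool) → sum (λ v → ⟦ (a == v) ∧ b ⟧) ≡ ⟦ b ⟧
sum-indicator {suc n} zero    b = trans (cong (⟦ b ⟧ +_) (sum-0 n)) (+-identityʳ ⟦ b ⟧)
sum-indicator {suc n} (suc a) b = sum-indicator a b

-- Double counting: `v` is counted only in the fibre over `f v`. With `f` the branch map at w, this
-- sums over the components of G - w without ever listing them.
sum-fibres : (f : Fin n → Fin k) (s : Fin n → Bool) →
  sum (λ x → # (λ v → (f v == x) ∧ s v)) ≡ # s
sum-fibres f s = trans (∑-comm (λ x v → ⟦ (f v == x) ∧ s v ⟧))
                       (sum-cong-≗ (λ v → sum-indicator (f v) (s v)))

-- Induction runs over graphs on `Fin m`, whereas a branch arises as a subset of `Fin n`; this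
-- renumbers it. `count` has the shape of the summands in `sum-fibres`.
record Enumeration (U : Fin n → Bool) : Set where
  field
    size      : ℕ
    at        : Fin size → Fin n
    injective : ∀ {i j} → at i ≡ at j → i ≡ j
    member    : ∀ i → U (at i) ≡ true
    onto      : ∀ v → U v ≡ true → ∃ λ i → at i ≡ v
    count     : ∀ s → # (λ v → U v ∧ s v) ≡ # (s ∘ at)

enumerate : (U : Fin n → Bool) → Enumeration U
enumerate {zero} U = record
  { size = 0 ; at = λ () ; injective = λ {} ; member = λ () ; onto = λ () ; count = λ _ → refl }
enumerate {suc n} U with U zero in U0 | enumerate (U ∘ suc)
... | true | E = record
  { size      = suc E.size
  ; at        = at
  ; injective = injective
  ; member    = λ { zero → U0 ; (suc i) → E.member i }
  ; onto      = λ { zero _ → zero , refl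
                  ; (suc v) Uv → let i , eq = E.onto v Uv in suc i , cong suc eq }
  ; count     = λ s → cong₂ _+_ (cong (λ b → ⟦ b ∧ s zero ⟧) U0) (E.count (s ∘ suc))
  }
  where
  module E = Enumeration E
  at : Fin (suc E.size) → Fin (suc n)
  at zero    = zero
  at (suc i) = suc (E.at i)
  injective : ∀ {i j} → at i ≡ at j → i ≡ j
  injective {zero}  {zero}  _  = refl
  injective {suc i} {suc j} eq = cong suc (E.injective (suc-injective eq))
... | false | E = record
  { size      = E.size
  ; at        = suc ∘ E.at
  ; injective = E.injective ∘ suc-injective
  ; member    = E.member
  ; onto      = λ { zero Uv → contradiction (trans (sym U0) Uv) λ ()
                  ; (suc v) Uv → let i , eq = E.onto v Uv in i , cong suc eq }
  ; count     = λ s → cong₂ _+_ (cong (λ b → ⟦ b ∧ s zero ⟧) U0) (E.count (s ∘ suc))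
  }
  where module E = Enumeration E

-- Pigeonhole: the enumeration stays injective when the missed vertex `w` is put in front.
size<n : {U : Fin n → Bool} (E : Enumeration U) {w : Fin n} → U w ≡ false → Enumeration.size E < n
size<n {n} {U} E {w} Uw = injective⇒≤ {f = f} f-injective
  where
  open Enumeration E
  at≢w : ∀ {i} → at i ≢ w
  at≢w {i} eq = contradiction (trans (sym Uw) (trans (cong U (sym eq)) (member i))) λ ()
  f : Fin (suc size) → Fin n
  f zero    = w
  f (suc i) = at i
  f-injective : ∀ {i j} → f i ≡ f j → i ≡ j
  f-injective {zero}  {zero}  _  = refl
  f-injective {zero}  {suc j} eq = contradiction (sym eq) at≢w
  f-injective {suc i} {zero}  eq = contradiction eq at≢w
  f-injective {suc i} {suc j} eq = cong suc (injective eq)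

-- Trees and RED:LD sets

module _ (G : Graph n) where
  open DecMembership (_≟_ {n}) using () renaming (_∈?_ to _∈ₗ?_)

  StepAvoiding : Fin n → Fin n → Fin n → Set
  StepAvoiding w u v = Adj G u v × u ≢ w × v ≢ w

  -- For simple graphs this is acyclicity: distinct neighbours of w lie in
  -- distinct components of G − w.
  Separated : Set
  Separated = ∀ w {x y} → Adj G w x → Adj G w y → Star (StepAvoiding w) x y → x ≡ y

  IsSeparatedTree : Set
  IsSeparatedTree = IsSimple G × (∀ u v → Star (Adj G) u v) × Separated

  walk⇒star : ∀ {u v} → Walk G u v → Star (Adj G) u v
  walk⇒star []      = ε
  walk⇒star (e ∷ p) = e ◅ walk⇒star p

  star⇒walk : ∀ {u v} → Star (Adj G) u v → Walk G u v
  star⇒walk ε       = []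
  star⇒walk (e ◅ p) = e ∷ star⇒walk p

  -- Walks that expose the list of their vertices, so that repetitions can be excluded and a `Chain`
  -- read off.
  data Trail : Fin n → Fin n → List (Fin n) → Set where
    stop : ∀ {u} → Trail u u (u ∷ [])
    step : ∀ {u v w l} → Adj G u v → Trail v w l → Trail u w (u ∷ l)

  close : ∀ {v w x y l} → Adj G v x → Trail x y l → Adj G y w → Chain G (v ∷ (l ∷ʳ w))
  close vx stop       yw = cons vx (cons yw one)
  close vx (step e t) yw = cons vx (close e t yw)

  drop-until : ∀ {P : Fin n → Set} {u v y l} → Trail v y l → Unique l → All P l → u ∈ₗ l →
    ∃ λ l′ → Trail u y l′ × Unique l′ × All P l′
  drop-until stop       u       a       (here refl) = _ , stop , u , a
  drop-until (step e t) u       a       (here refl) = _ , step e t , u , a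
  drop-until (step e t) (_ ∷ u) (_ ∷ a) (there u∈l) = drop-until t u a u∈l

  -- If `x` occurs again on the loop-free remainder, the walk is restarted at that occurrence, which
  -- drops the detour.
  loop-erase : ∀ {w x y} → x ≢ w → Star (StepAvoiding w) x y →
    ∃ λ l → Trail x y l × Unique l × All (_≢ w) l
  loop-erase x≢w ε = _ , stop , [] ∷ [] , x≢w ∷ []
  loop-erase {x = x} x≢w ((e , _ , v≢w) ◅ p)
    with l , t , u , a ← loop-erase v≢w p
    with x ∈ₗ? l
  ... | yes x∈l = drop-until t u a x∈l
  ... | no  x∉l = x ∷ l , step e t , ¬Any⇒All¬ l x∉l ∷ u , x≢w ∷ a

  walk-to-end : ∀ {x y} l → All (x ≢_) (y ∷ l) → Chain G ((y ∷ l) ∷ʳ x) →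
    ∃ λ z → z ∈ₗ (y ∷ l) × Adj G z x × Star (StepAvoiding x) y z
  walk-to-end []      _               (cons yx one) = _ , here refl , yx , ε
  walk-to-end (v ∷ l) (x≢y ∷ x≢v ∷ a) (cons yv c)
    with z , z∈ , zx , p ← walk-to-end l (x≢v ∷ a) c =
    z , there z∈ , zx , (yv , ≢-sym x≢y , ≢-sym x≢v) ◅ p

module Simple {G : Graph n} (simple : IsSimple G) where

  adj-sym : ∀ {u v} → Adj G u v → Adj G v u
  adj-sym {u} {v} uv = trans (proj₁ simple v u) uv

  adj⇒≢ : ∀ {u v} → Adj G u v → u ≢ v
  adj⇒≢ {u} uv refl = contradiction (trans (sym uv) (proj₂ simple u)) λ ()

  reverse-avoiding : ∀ {w x y} → Star (StepAvoiding G w) x y → Star (StepAvoiding G w) y x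
  reverse-avoiding = Star.reverse λ (e , u≢w , v≢w) → adj-sym e , v≢w , u≢w

  -- A loop-free walk between two different neighbours of `w` that avoids `w` closes up through `w`
  -- to a cycle.
  acyclic⇒separated : ¬ HasCycle G → Separated G
  acyclic⇒separated acyclic w {x} {y} wx wy p with x ≟ y
  ... | yes x≡y = x≡y
  ... | no  x≢y with loop-erase G (≢-sym (adj⇒≢ wx)) p
  ...   | _ , stop , _ = contradiction refl x≢y
  -- The trail has at least two vertices; splitting it into two clauses makes the length condition
  -- of `HasCycle` compute.
  ...   | _ , t@(step _ stop)       , u , a = contradiction
    (w , _ , All.map ≢-sym a ∷ u , s≤s (s≤s z≤n) , close G wx t (adj-sym wy)) acyclic
  ...   | _ , t@(step _ (step _ _)) , u , a = contradiction
    (w , _ , All.map ≢-sym a ∷ u , s≤s (s≤s z≤n) , close G wx t (adj-sym wy)) acyclic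

  -- The second and the last vertex of a cycle are neighbours of the first, and the rest of the
  -- cycle joins them while avoiding it, so they would coincide.
  separated⇒acyclic : Separated G → ¬ HasCycle G
  separated⇒acyclic sep (x , y ∷ v ∷ l , (x≢y ∷ x≢v ∷ x∉l) ∷ (y∉l ∷ _) , _ , cons xy (cons yv c))
    with z , z∈l , zx , p ← walk-to-end G l (x≢v ∷ x∉l) c =
    All.lookup y∉l z∈l (sep x xy (adj-sym zx) ((yv , ≢-sym x≢y , ≢-sym x≢v) ◅ p))
  separated⇒acyclic sep (x , y ∷ [] , _ , s≤s () , _)

isTree⇒isSeparatedTree : {G : Graph n} → IsTree G → IsSeparatedTree G
isTree⇒isSeparatedTree {G = G} (simple , conn , acyclic) =
  simple , (λ u v → walk⇒star G (conn u v)) , Simple.acyclic⇒separated simple acyclic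

isSeparatedTree⇒isTree : {G : Graph n} → IsSeparatedTree G → IsTree G
isSeparatedTree⇒isTree {G = G} (simple , conn , sep) =
  simple , (λ u v → star⇒walk G (conn u v)) , Simple.separated⇒acyclic simple sep

module Embedding {H : Graph m} {G : Graph n} (e : Fin m → Fin n)
  (e-injective : ∀ {i j} → e i ≡ e j → i ≡ j) (e-edges : ∀ i j → H i j ≡ G (e i) (e j)) where

  adj⁺ : ∀ {i j} → Adj H i j → Adj G (e i) (e j)
  adj⁺ = trans (sym (e-edges _ _))

  adj⁻ : ∀ {i j} → Adj G (e i) (e j) → Adj H i j
  adj⁻ = trans (e-edges _ _)

  isSimple : IsSimple G → IsSimple H
  isSimple (symm , irr) =
    (λ i j → trans (e-edges i j) (trans (symm (e i) (e j)) (sym (e-edges j i)))) ,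
    (λ i → trans (e-edges i i) (irr (e i)))

  separated : Separated G → Separated H
  separated sep w wx wy p = e-injective (sep (e w) (adj⁺ wx) (adj⁺ wy)
    (Star.gmap e (λ (uv , u≢w , v≢w) → adj⁺ uv , u≢w ∘ e-injective , v≢w ∘ e-injective) p))

DominatedAt : Graph n → (Fin n → Bool) → Fin n → Set
DominatedAt G s v =
  (s v ≡ true → ∃ λ t → s t ≡ true × Adj G v t) ×
  (s v ≡ false → ∃₂ λ t u → t ≢ u × (s t ≡ true × Adj G v t) × (s u ≡ true × Adj G v u))

-- In a tree this characterises RED:LD sets: the separation requirements follow
-- from the absence of triangles and 4-cycles.
DoublyDominating : Graph n → (Fin n → Bool) → Set
DoublyDominating G s = ∀ v → DominatedAt G s v

∉⇒lookup≡false : {S : Subset n} {v : Fin n} → v ∉ S → lookup S v ≡ false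
∉⇒lookup≡false {S = S} {v} v∉S with lookup S v in eq
... | true  = contradiction (lookup⇒[]= v S eq) v∉S
... | false = refl

lookup≡false⇒∉ : {S : Subset n} {v : Fin n} → lookup S v ≡ false → v ∉ S
lookup≡false⇒∉ eq v∈S = contradiction (trans (sym eq) ([]=⇒lookup v∈S)) λ ()

x∉p-x : (p : Subset n) {x : Fin n} → x ∉ p - x
x∉p-x (_ ∷ p) {zero}  ()
x∉p-x (_ ∷ p) {suc x} (there x∈) = x∉p-x p x∈

-- Delete `v` itself or, if `v` lies outside S, the dominator found first: the reduced set must
-- still dominate `v`.
isREDLD⇒doublyDominating : {G : Graph n} {S : Subset n} → IsREDLD G S → DoublyDominating G (lookup S)
isREDLD⇒doublyDominating {G = G} {S} (ld , ldm) v = inside-case , outside-case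
  where
  inside-case : lookup S v ≡ true → ∃ λ t → lookup S t ≡ true × Adj G v t
  inside-case sv =
    let t , t∈ , vt = proj₁ (ldm v (lookup⇒[]= v S sv)) v (x∉p-x S)
    in t , []=⇒lookup (p─q⊆p S _ t∈) , vt
  outside-case : lookup S v ≡ false → ∃₂ λ t u → t ≢ u ×
    (lookup S t ≡ true × Adj G v t) × (lookup S u ≡ true × Adj G v u)
  outside-case sv =
    let t , t∈S , vt = proj₁ ld v (lookup≡false⇒∉ sv)
        u , u∈  , vu = proj₁ (ldm t t∈S) v (lookup≡false⇒∉ sv ∘ p─q⊆p S _)
    in t , u , (λ t≡u → x∉p-x S (subst (_∈ S - t) (sym t≡u) u∈)) , ([]=⇒lookup t∈S , vt) , ([]=⇒lookup (p─q⊆p S _ u∈) , vu)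

module _ {G : Graph n} (tree : IsSeparatedTree G) where
  open Simple (proj₁ tree)

  no-triangle : ∀ {u v w} → Adj G u v → Adj G u w → Adj G v w → ⊥
  no-triangle uv uw vw = adj⇒≢ vw (proj₂ (proj₂ tree) _ uv uw
    ((vw , ≢-sym (adj⇒≢ uv) , ≢-sym (adj⇒≢ uw)) ◅ ε))

  -- Otherwise u, s, v, t form a 4-cycle: the walk s, v, t avoids u and joins two of its neighbours.
  unique-common-neighbour : ∀ {u v s t} → u ≢ v → Adj G u s → Adj G u t → Adj G v s → Adj G v t → s ≡ t
  unique-common-neighbour u≢v us ut vs vt = proj₂ (proj₂ tree) _ us ut
    ((adj-sym vs , ≢-sym (adj⇒≢ us) , ≢-sym u≢v) ◅ (vt , ≢-sym u≢v , ≢-sym (adj⇒≢ ut)) ◅ ε)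

  doublyDominating⇒isREDLD : {S : Subset n} → DoublyDominating G (lookup S) → IsREDLD G S
  doublyDominating⇒isREDLD {S} dd = (dominates , separates) , λ x _ → dominates- x , separates- x
    where
    outside-case : ∀ v → v ∉ S → ∃₂ λ t u → t ≢ u × (t ∈ S × Adj G v t) × (u ∈ S × Adj G v u)
    outside-case v v∉S =
      let t , u , t≢u , (st , vt) , (su , vu) = proj₂ (dd v) (∉⇒lookup≡false v∉S)
      in t , u , t≢u , (lookup⇒[]= t S st , vt) , (lookup⇒[]= u S su , vu)
    dominates : ∀ v → v ∉ S → ∃ λ s → s ∈ S × Adj G v s
    dominates v v∉S = let t , _ , _ , vt , _ = outside-case v v∉S in t , vt
    separates : ∀ u v → u ∉ S → v ∉ S → u ≢ v →
      ¬ (∀ s → s ∈ S → (Adj G u s → Adj G v s) × (Adj G v s → Adj G u s))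
    separates u v u∉S _ u≢v same =
      let s , t , s≢t , (s∈S , us) , (t∈S , ut) = outside-case u u∉S
      in s≢t (unique-common-neighbour u≢v us ut (proj₁ (same s s∈S) us) (proj₁ (same t t∈S) ut))
    avoid : ∀ x v → v ∉ S → ∃ λ s → s ∈ S - x × Adj G v s
    avoid x v v∉S with s , t , s≢t , (s∈S , vs) , (t∈S , vt) ← outside-case v v∉S with s ≟ x
    ... | yes refl = t , x∈p∧x≢y⇒x∈p-y t∈S (≢-sym s≢t) , vt
    ... | no  s≢x  = s , x∈p∧x≢y⇒x∈p-y s∈S s≢x , vs
    removed : ∀ x v → v ∉ S - x → v ∈ S → v ≡ x
    removed x v v∉ v∈S with v ≟ x
    ... | yes v≡x = v≡x
    ... | no  v≢x = contradiction (x∈p∧x≢y⇒x∈p-y v∈S v≢x) v∉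
    dominates- : ∀ x v → v ∉ S - x → ∃ λ s → s ∈ S - x × Adj G v s
    dominates- x v v∉ with v ∈? S
    ... | no  v∉S = avoid x v v∉S
    ... | yes v∈S with refl ← removed x v v∉ v∈S
                  with s , ss , vs ← proj₁ (dd v) ([]=⇒lookup v∈S) =
      s , x∈p∧x≢y⇒x∈p-y (lookup⇒[]= s S ss) (≢-sym (adj⇒≢ vs)) , vs
    Same : Fin n → Fin n → Fin n → Set
    Same x u v = ∀ s → s ∈ S - x → (Adj G u s → Adj G v s) × (Adj G v s → Adj G u s)
    same-sym : ∀ {x u v} → Same x u v → Same x v u
    same-sym same s s∈ = proj₂ (same s s∈) , proj₁ (same s s∈)
    -- If two neighbours of u in S survived the removal of x, u and v would lie on a 4-cycle.
    outside- : ∀ x u v → u ≢ v → Same x u v → u ∉ S → Adj G u x × ∃ λ t → Adj G u t × Adj G v t × t ≢ x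
    outside- x u v u≢v same u∉S
      with s , t , s≢t , (s∈S , us) , (t∈S , ut) ← outside-case u u∉S
      with s ≟ x | t ≟ x
    ... | yes refl | yes refl = contradiction refl s≢t
    ... | yes refl | no t≢x = us , t , ut , proj₁ (same t (x∈p∧x≢y⇒x∈p-y t∈S t≢x)) ut , t≢x
    ... | no s≢x | yes refl = ut , s , us , proj₁ (same s (x∈p∧x≢y⇒x∈p-y s∈S s≢x)) us , s≢x
    ... | no s≢x | no t≢x = contradiction
      (unique-common-neighbour u≢v us ut
        (proj₁ (same s (x∈p∧x≢y⇒x∈p-y s∈S s≢x)) us) (proj₁ (same t (x∈p∧x≢y⇒x∈p-y t∈S t≢x)) ut)) s≢t
    separates- : ∀ x u v → u ∉ S - x → v ∉ S - x → u ≢ v → ¬ Same x u v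
    separates- x u v u∉ v∉ u≢v same with u ∈? S | v ∈? S
    -- Both vertices are adjacent to the deleted `x` and to the surviving `t`, which is a 4-cycle.
    ... | no u∉S | no v∉S =
      let ux , t , ut , vt , t≢x = outside- x u v u≢v same u∉S
          vx , _ = outside- x v u (≢-sym u≢v) (same-sym same) v∉S
      in t≢x (unique-common-neighbour u≢v ut ux vt vx)
    ... | yes u∈S | yes v∈S = u≢v (trans (removed x u u∉ u∈S) (sym (removed x v v∉ v∈S)))
    -- Now v is the deleted vertex itself, and the shared neighbour t closes a triangle u, x, t.
    ... | no u∉S | yes v∈S with refl ← removed x v v∉ v∈S =
      let ux , t , ut , xt , _ = outside- x u v u≢v same u∉S in no-triangle ux ut xt
    ... | yes u∈S | no v∉S with refl ← removed x u u∉ u∈S =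
      let vx , t , vt , xt , _ = outside- x v u (≢-sym u≢v) (same-sym same) v∉S in no-triangle vx vt xt

-- Branches at a vertex and the lower bound

module Branches {G : Graph n} (tree : IsSeparatedTree G) (w : Fin n) where
  open Simple (proj₁ tree)

  private
    sep = proj₂ (proj₂ tree)
    conn = proj₁ (proj₂ tree)

    first-arrival : ∀ {v} → Star (Adj G) v w → v ≢ w → ∃ λ x → Adj G w x × Star (StepAvoiding G w) v x
    first-arrival ε v≢w = contradiction refl v≢w
    first-arrival {v} (_◅_ {j = u} vu p) v≢w with u ≟ w
    ... | yes refl = v , adj-sym vu , ε
    ... | no  u≢w  = let x , wx , q = first-arrival p u≢w in x , wx , (vu , v≢w , u≢w) ◅ q

    branch′ : ∀ v → ∃ λ x → (v ≡ w × x ≡ w) ⊎ (v ≢ w × Adj G w x × Star (StepAvoiding G w) v x)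
    branch′ v with v ≟ w
    ... | yes v≡w = w , inj₁ (v≡w , refl)
    ... | no  v≢w = let x , wx , p = first-arrival (conn v w) v≢w in x , inj₂ (v≢w , wx , p)

  -- The neighbour of w whose component in G − w contains v; branch w = w.
  branch : Fin n → Fin n
  branch v = proj₁ (branch′ v)

  branch-self : branch w ≡ w
  branch-self with branch′ w
  ... | _ , inj₁ (_ , x≡w) = x≡w
  ... | _ , inj₂ (w≢w , _) = contradiction refl w≢w

  branch≢w⇒≢w : ∀ {v} → branch v ≢ w → v ≢ w
  branch≢w⇒≢w bv≢w refl = bv≢w branch-self

  branch-adj : ∀ {v} → v ≢ w → Adj G w (branch v)
  branch-adj {v} v≢w with branch′ v
  ... | _ , inj₁ (v≡w , _)    = contradiction v≡w v≢w
  ... | _ , inj₂ (_ , wx , _) = wx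

  branch-star : ∀ {v} → v ≢ w → Star (StepAvoiding G w) v (branch v)
  branch-star {v} v≢w with branch′ v
  ... | _ , inj₁ (v≡w , _)   = contradiction v≡w v≢w
  ... | _ , inj₂ (_ , _ , p) = p

  branch-unique : ∀ {v x} → v ≢ w → Adj G w x → Star (StepAvoiding G w) v x → branch v ≡ x
  branch-unique v≢w wx p = sep w (branch-adj v≢w) wx (reverse-avoiding (branch-star v≢w) ◅◅ p)

  branch-neighbour : ∀ {x} → Adj G w x → branch x ≡ x
  branch-neighbour wx = branch-unique (≢-sym (adj⇒≢ wx)) wx ε

  branch-step : ∀ {u v} → Adj G u v → u ≢ w → v ≢ w → branch u ≡ branch v
  branch-step uv u≢w v≢w =
    branch-unique u≢w (branch-adj v≢w) ((uv , u≢w , v≢w) ◅ branch-star v≢w)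

  module Branch {x : Fin n} (wx : Adj G w x) where
    private
      x≢w : x ≢ w
      x≢w = ≢-sym (adj⇒≢ wx)

    enumeration : Enumeration (λ v → branch v == x)
    enumeration = enumerate (λ v → branch v == x)
    open Enumeration enumeration public

    subtree : Graph size
    subtree i j = G (at i) (at j)

    branch-at : ∀ i → branch (at i) ≡ x
    branch-at i = ==⇒≡ (member i)

    onto′ : ∀ {v} → branch v ≡ x → ∃ λ i → at i ≡ v
    onto′ {v} refl = onto v (==-refl (branch v))

    at≢w : ∀ i → at i ≢ w
    at≢w i = branch≢w⇒≢w {at i} λ eq → x≢w (trans (sym (branch-at i)) eq)

    stays : ∀ i {v} → Adj G (at i) v → v ≢ w → ∃ λ j → at j ≡ v
    stays i e v≢w = onto′ (trans (sym (branch-step e (at≢w i) v≢w)) (branch-at i))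

    root : Fin size
    root = proj₁ (onto′ {x} (branch-neighbour wx))

    at-root : at root ≡ x
    at-root = proj₂ (onto′ {x} (branch-neighbour wx))

    private
      -- The end point comes through an equation so that the walk can be matched on; a step that
      -- avoids w cannot leave the branch.
      lift : ∀ i j {v} → Star (StepAvoiding G w) (at i) v → v ≡ at j → Star (Adj subtree) i j
      lift i j ε eq with refl ← injective eq = ε
      lift i j ((e , _ , v≢w) ◅ p) eq with k , refl ← stays i e v≢w = e ◅ lift k j p eq

    isTree : IsSeparatedTree subtree
    isTree = Embedding.isSimple at injective (λ _ _ → refl) (proj₁ tree)
           , (λ i j → lift i j (branch-star (at≢w i) ◅◅
               subst (λ y → Star _ y (at j)) (trans (branch-at j) (sym (branch-at i)))
                     (reverse-avoiding (branch-star (at≢w j)))) refl)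
           , Embedding.separated at injective (λ _ _ → refl) sep

    size< : size < n
    size< = size<n enumeration {w} (≢⇒== λ eq → x≢w (trans (sym eq) branch-self))

    doublyDominating : ∀ {s} → s w ≡ false → DoublyDominating G s → DoublyDominating subtree (s ∘ at)
    doublyDominating {s} sw dd i = inside-case , outside-case
      where
      s⇒≢w : ∀ {v} → s v ≡ true → v ≢ w
      s⇒≢w sv refl = contradiction (trans (sym sv) sw) λ ()
      inside-case : s (at i) ≡ true → _
      inside-case si with t , st , e ← proj₁ (dd (at i)) si with j , refl ← stays i e (s⇒≢w st) =
        j , st , e
      outside-case : s (at i) ≡ false → _
      outside-case si with t , u , t≢u , (st , et) , (su , eu) ← proj₂ (dd (at i)) si
        with j , refl ← stays i et (s⇒≢w st) | k , refl ← stays i eu (s⇒≢w su) =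
        j , k , t≢u ∘ cong at , (st , et) , (su , eu)

two-members⇒2≤n : {u v : Fin n} → u ≢ v → 2 ≤ n
two-members⇒2≤n {u = u} {v} u≢v =
  subst (2 ≤_) (#-true _) (length≤# {s = const true} ((u≢v ∷ []) ∷ [] ∷ []) (refl ∷ refl ∷ []))

-- Excludes the one-vertex tree. When S is the whole vertex set, the bound 2n + 2 ≤ 3n says
-- precisely that n ≥ 2.
doublyDominating⇒2≤n : {G : Graph n} → IsSimple G → {s : Fin n → Bool} →
  DoublyDominating G s → Fin n → 2 ≤ n
doublyDominating⇒2≤n simple {s} dd v with s v in sv
... | true  = let t , _ , vt = proj₁ (dd v) sv in two-members⇒2≤n (Simple.adj⇒≢ simple vt)
... | false = let t , u , t≢u , _ = proj₂ (dd v) sv in two-members⇒2≤n t≢u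

-- The vertex argument excludes the empty graph, which satisfies `IsSeparatedTree` vacuously but
-- violates the inequality.
LowerBound : ℕ → Set
LowerBound n = {G : Graph n} → IsSeparatedTree G → {s : Fin n → Bool} → DoublyDominating G s →
  Fin n → 2 * n + 2 ≤ 3 * # s

-- Adds up 2m + 2 ≤ 3|S ∩ T| over the branches T of order m, where the 2 on the right pays for w.
-- Neighbours enter as a list, so that knowing some of them suffices: two yield the bound for n, and
-- four are too many for a tight set.
branch-inequality : {G : Graph n} → IsSeparatedTree G → {s : Fin n → Bool} → DoublyDominating G s →
  (∀ {m} → m < n → LowerBound m) → {w : Fin n} → s w ≡ false →
  {l : List (Fin n)} → Unique l → All (Adj G w) l → 2 * n + 2 * length l ≤ 3 * # s + 2
branch-inequality {n = n} {G = G} tree {s} dd ih {w} sw {l} unique neighbours = begin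
  2 * n + 2 * length l               ≤⟨ +-monoʳ-≤ (2 * n) (*-monoʳ-≤ 2 (length≤# unique neighbours)) ⟩
  2 * n + 2 * # (G w)                ≡⟨ cong (λ a → 2 * a + 2 * # (G w)) (trans (sum-fibres branch (const true)) (#-true n)) ⟨
  2 * sum (λ x → # (fibre x (const true))) + 2 * # (G w)
                                     ≡⟨ linear 2 2 (λ x → # (fibre x (const true))) (λ x → ⟦ G w x ⟧) ⟩
  sum (λ x → 2 * # (fibre x (const true)) + 2 * ⟦ G w x ⟧)
                                     ≤⟨ sum-mono-≤ fibre-inequality ⟩
  sum (λ x → 3 * # (fibre x s) + 2 * ⟦ (w == x) ∧ true ⟧)
                                     ≡⟨ linear 3 2 (λ x → # (fibre x s)) (λ x → ⟦ (w == x) ∧ true ⟧) ⟨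
  3 * sum (λ x → # (fibre x s)) + 2 * sum (λ x → ⟦ (w == x) ∧ true ⟧)
                                     ≡⟨ cong₂ (λ a b → 3 * a + 2 * b) (sum-fibres branch s) (sum-indicator w true) ⟩
  3 * # s + 2                        ∎
  where
  open ≤-Reasoning
  open Simple (proj₁ tree)
  open Branches tree w
  fibre : Fin n → (Fin n → Bool) → Fin n → Bool
  fibre x t v = (branch v == x) ∧ t v
  linear : ∀ a b (f g : Fin n → ℕ) → a * sum f + b * sum g ≡ sum (λ x → a * f x + b * g x)
  linear a b f g = trans (cong₂ _+_ (*-distribˡ-sum a f) (*-distribˡ-sum b g))
                         (sym (∑-distrib-+ (λ x → a * f x) (λ x → b * g x)))
  not-w : ∀ {x} → w ≢ x → G w x ≡ false → ∀ v → fibre x (const true) v ≡ false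
  not-w {x} w≢x wx v with branch v ≟ x
  ... | no  _    = refl
  ... | yes refl = contradiction (trans (sym (branch-adj {v} λ { refl → w≢x (sym branch-self) })) wx) λ ()
  only-w : ∀ v → ⟦ fibre w (const true) v ⟧ ≤ ⟦ (w == v) ∧ true ⟧
  only-w v with branch v ≟ w
  ... | no  _  = z≤n
  ... | yes eq with w ≟ v
  ...   | yes _  = ≤-refl
  ...   | no w≢v = contradiction (sym eq) (adj⇒≢ (branch-adj {v} (≢-sym w≢v)))
  -- A neighbour x of w contributes the induction hypothesis for its branch, w itself contributes at
  -- most 2 on the left, and over any other vertex the fibre is empty.
  fibre-inequality : ∀ x →
    2 * # (fibre x (const true)) + 2 * ⟦ G w x ⟧ ≤ 3 * # (fibre x s) + 2 * ⟦ (w == x) ∧ true ⟧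
  fibre-inequality x with w ≟ x | G w x in wx
  ... | yes refl | true = contradiction refl (adj⇒≢ wx)
  ... | yes refl | false = begin
    2 * # (fibre x (const true)) + 0 ≡⟨ +-identityʳ _ ⟩
    2 * # (fibre x (const true))     ≤⟨ *-monoʳ-≤ 2 (≤-trans (sum-mono-≤ only-w) (≤-reflexive (sum-indicator w true))) ⟩
    2                                ≤⟨ m≤n+m 2 (3 * # (fibre x s)) ⟩
    3 * # (fibre x s) + 2            ∎
  ... | no w≢x | false = begin
    2 * # (fibre x (const true)) + 0 ≡⟨ cong (λ a → 2 * a + 0) (trans (#-cong (not-w w≢x wx)) (sum-0 n)) ⟩
    0                                ≤⟨ z≤n ⟩
    3 * # (fibre x s) + 0            ∎
  ... | no w≢x | true = begin
    2 * # (fibre x (const true)) + 2 ≡⟨ cong (λ a → 2 * a + 2) (trans (B.count (const true)) (#-true B.size)) ⟩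
    2 * B.size + 2                   ≤⟨ ih B.size< B.isTree (B.doublyDominating sw dd) B.root ⟩
    3 * # (s ∘ B.at)                 ≡⟨ cong (3 *_) (B.count s) ⟨
    3 * # (fibre x s)                ≡⟨ +-identityʳ _ ⟨
    3 * # (fibre x s) + 0            ∎
    where module B = Branch wx

find-outside : (s : Fin n → Bool) → (∃ λ w → s w ≡ false) ⊎ (∀ v → s v ≡ true)
find-outside s with any? (λ w → s w Bool.≟ false)
... | yes found = inj₁ found
... | no  none  = inj₂ λ v → ¬-not (λ sv → none (v , sv))

lowerBound : ∀ n → LowerBound n
lowerBound = <-rec LowerBound bound
  where
  bound : ∀ n → (∀ {m} → m < n → LowerBound m) → LowerBound n
  bound n ih tree {s} dd v with find-outside s
  ... | inj₂ all = begin
    2 * n + 2 ≤⟨ +-monoʳ-≤ (2 * n) (doublyDominating⇒2≤n (proj₁ tree) dd v) ⟩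
    2 * n + n ≡⟨ +-comm (2 * n) n ⟩
    3 * n     ≡⟨ cong (3 *_) (trans (#-cong all) (#-true n)) ⟨
    3 * # s   ∎
    where open ≤-Reasoning
  ... | inj₁ (w , sw) with x , y , x≢y , (_ , wx) , (_ , wy) ← proj₂ (dd w) sw =
    +-cancelʳ-≤ 2 _ _ (≤-trans (≤-reflexive (+-assoc (2 * n) 2 2))
      (branch-inequality tree dd ih sw ((x≢y ∷ []) ∷ [] ∷ []) (wx ∷ wy ∷ [])))

-- Sets attaining the bound

⌈/3⌉-bounds : ∀ a → a ≤ 3 * ⌈ a /3⌉ × 3 * ⌈ a /3⌉ ≤ a + 2
⌈/3⌉-bounds a = lower , upper
  where
  open ≤-Reasoning
  lower : a ≤ 3 * ⌈ a /3⌉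
  lower = +-cancelʳ-≤ 2 _ _ (begin
    a + 2                           ≡⟨ m≡m%n+[m/n]*n (a + 2) 3 ⟩
    (a + 2) % 3 + ⌈ a /3⌉ * 3       ≤⟨ +-monoˡ-≤ (⌈ a /3⌉ * 3) (s≤s⁻¹ (m%n<n (a + 2) 3)) ⟩
    2 + ⌈ a /3⌉ * 3                 ≡⟨ cong (2 +_) (*-comm ⌈ a /3⌉ 3) ⟩
    2 + 3 * ⌈ a /3⌉                 ≡⟨ +-comm 2 _ ⟩
    3 * ⌈ a /3⌉ + 2                 ∎)
  upper : 3 * ⌈ a /3⌉ ≤ a + 2
  upper = subst (_≤ a + 2) (*-comm ⌈ a /3⌉ 3) (m/n*n≤m (a + 2) 3)

-- From 3b ≤ 3c + 2 < 3(c + 1). A window from a to a + 2 thus holds at most one multiple of 3, which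
-- settles both minimality and the value of the ceiling.
third-≤ : ∀ {a b c} → a ≤ 3 * c → 3 * b ≤ a + 2 → b ≤ c
third-≤ {a} {b} {c} a≤3c 3b≤a+2 = s≤s⁻¹ (*-cancelˡ-< 3 b (suc c) (begin-strict
  3 * b       ≤⟨ 3b≤a+2 ⟩
  a + 2       ≤⟨ +-monoˡ-≤ 2 a≤3c ⟩
  3 * c + 2   <⟨ +-monoʳ-< (3 * c) (n<1+n 2) ⟩
  3 * c + 3   ≡⟨ trans (+-comm (3 * c) 3) (sym (*-suc 3 c)) ⟩
  3 * suc c   ∎))
  where open ≤-Reasoning

-- Optimality as an inequality: 2n + 4 is the largest value that 3⌈(2n + 2)/3⌉ can take.
record Tight (G : Graph n) (S : Subset n) : Set where
  constructor tight
  field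
    tree       : IsSeparatedTree G
    2≤n        : 2 ≤ n
    dominating : DoublyDominating G (lookup S)
    small      : 3 * ∣ S ∣ ≤ 2 * n + 4

vertex : 2 ≤ n → Fin n
vertex (s≤s _) = zero

bound-REDLD : {G : Graph n} → IsSeparatedTree G → 2 ≤ n → {S : Subset n} → IsREDLD G S → 2 * n + 2 ≤ 3 * ∣ S ∣
bound-REDLD tree 2≤n {S} red = subst (λ c → _ ≤ 3 * c) (sym (∣p∣≡#lookup S))
  (lowerBound _ tree (isREDLD⇒doublyDominating red) (vertex 2≤n))

tight-bound : {G : Graph n} {S : Subset n} → Tight G S → 2 * n + 2 ≤ 3 * ∣ S ∣
tight-bound {S = S} (tight tree 2≤n dd _) = bound-REDLD tree 2≤n {S} (doublyDominating⇒isREDLD tree dd)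

tight⇒min : {G : Graph n} {S : Subset n} → Tight G S → IsMinREDLD G S
tight⇒min {n} {S = S} (tight tree 2≤n dd small) =
  doublyDominating⇒isREDLD tree dd ,
  λ S′ red → third-≤ (bound-REDLD tree 2≤n red) (subst (3 * ∣ S ∣ ≤_) (sym (+-assoc (2 * n) 2 2)) small)

tight⇒TMin : {G : Graph n} {S : Subset n} → Tight G S → TMin n G
tight⇒TMin {n} {S = S} t@(tight tree 2≤n dd small) =
  isSeparatedTree⇒isTree tree , 2≤n , S , tight⇒min t ,
  ≤-antisym (third-≤ (proj₁ (⌈/3⌉-bounds (2 * n + 2))) (subst (3 * ∣ S ∣ ≤_) (sym (+-assoc (2 * n) 2 2)) small))
            (third-≤ (tight-bound t) (proj₂ (⌈/3⌉-bounds (2 * n + 2))))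

min⇒tight : {G : Graph n} → TMin n G → {S : Subset n} → IsMinREDLD G S → Tight G S
min⇒tight {n} (tree , 2≤n , S₀ , min₀ , size) {S} (red , least) =
  tight (isTree⇒isSeparatedTree tree) 2≤n (isREDLD⇒doublyDominating red) (begin
    3 * ∣ S ∣                 ≤⟨ *-monoʳ-≤ 3 (least S₀ (proj₁ min₀)) ⟩
    3 * ∣ S₀ ∣                ≡⟨ cong (3 *_) size ⟩
    3 * ⌈ 2 * n + 2 /3⌉       ≤⟨ proj₂ (⌈/3⌉-bounds (2 * n + 2)) ⟩
    2 * n + 2 + 2             ≡⟨ +-assoc (2 * n) 2 2 ⟩
    2 * n + 4                 ∎)
  where open ≤-Reasoning

TMin⇒tight : {G : Graph n} → TMin n G → ∃ (Tight G)
TMin⇒tight tm@(_ , _ , S , min , _) = S , min⇒tight tm min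

-- In the counting proof of the lower bound, the excess is
-- Σ_{v ∈ S} (deg_S v − 1) + 2 Σ_{v ∉ S} (deg_S v − 2) + 2 e(V∖S).
Excess : (n : ℕ) → Subset n → ℕ → Set
Excess n S r = 3 * ∣ S ∣ ≡ 2 * n + 2 + r

excess : {G : Graph n} {S : Subset n} → Tight G S → ∃ λ r → r ≤ 2 × Excess n S r
excess {n} {S = S} t with r , eq ← m≤n⇒∃[o]m+o≡n (tight-bound t) =
  r , +-cancelˡ-≤ (2 * n + 2) _ _ (begin
    2 * n + 2 + r ≡⟨ eq ⟩
    3 * ∣ S ∣     ≤⟨ Tight.small t ⟩
    2 * n + 4     ≡⟨ +-assoc (2 * n) 2 2 ⟨
    2 * n + 2 + 2 ∎) , sym eq
  where open ≤-Reasoning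

-- Adding n to both sides of `Excess` turns 2n into 3n, which vanishes modulo 3 together with 3|S|.
excess-mod : (S : Subset n) (r : ℕ) → Excess n S r → n % 3 ≡ (2 + r) % 3
excess-mod {n} S r eq = begin
  n % 3                     ≡⟨ [m+kn]%n≡m%n n ∣ S ∣ 3 ⟨
  (n + ∣ S ∣ * 3) % 3       ≡⟨ cong (λ a → (n + a) % 3) (trans (*-comm ∣ S ∣ 3) eq) ⟩
  (n + (2 * n + 2 + r)) % 3 ≡⟨ cong (_% 3) (regroup n r) ⟩
  (2 + r + n * 3) % 3       ≡⟨ [m+kn]%n≡m%n (2 + r) n 3 ⟩
  (2 + r) % 3               ∎
  where
  open ≡-Reasoning
  regroup : ∀ n r → n + (2 * n + 2 + r) ≡ 2 + r + n * 3
  regroup = solve-∀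

-- Among the excesses 0, 1, 2 the residue of n selects one; in this way the congruences of the
-- operations become arithmetic.
excess-0 : {G : Graph n} {S : Subset n} → Tight G S → n % 3 ≡ 2 → Excess n S 0
excess-0 {S = S} t mod with excess t
... | 0 , _ , eq = eq
... | 1 , _ , eq = contradiction (trans (sym mod) (excess-mod S 1 eq)) λ ()
... | 2 , _ , eq = contradiction (trans (sym mod) (excess-mod S 2 eq)) λ ()
... | suc (suc (suc _)) , s≤s (s≤s ()) , _

excess-1 : {G : Graph n} {S : Subset n} → Tight G S → n % 3 ≡ 0 → Excess n S 1
excess-1 {S = S} t mod with excess t
... | 0 , _ , eq = contradiction (trans (sym mod) (excess-mod S 0 eq)) λ ()
... | 1 , _ , eq = eq
... | 2 , _ , eq = contradiction (trans (sym mod) (excess-mod S 2 eq)) λ ()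
... | suc (suc (suc _)) , s≤s (s≤s ()) , _

∣++∣ : (p : Subset m) (q : Subset k) → ∣ p ++ q ∣ ≡ ∣ p ∣ + ∣ q ∣
∣++∣ []          q = refl
∣++∣ (true  ∷ p) q = cong suc (∣++∣ p q)
∣++∣ (false ∷ p) q = ∣++∣ p q

-- Attaching a vertex to a forest

-- e identifies H with a union of connected components of G.
module ComponentEmbedding {H : Graph m} {G : Graph n} (e : Fin m → Fin n)
  (e-injective : ∀ {i j} → e i ≡ e j → i ≡ j) (e-edges : ∀ i j → H i j ≡ G (e i) (e j))
  (e-closed : ∀ {i v} → Adj G (e i) v → ∃ λ j → v ≡ e j) where
  open Embedding {H = H} {G} e e-injective e-edges public

  restrict : ∀ {i v} → Star (Adj G) (e i) v → ∃ λ j → v ≡ e j × Star (Adj H) i j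
  restrict ε       = _ , refl , ε
  restrict (a ◅ p) with j , refl ← e-closed a with k , eq , q ← restrict p = k , eq , adj⁻ a ◅ q

  restrict-avoiding : ∀ {w i v} → Star (StepAvoiding G (e w)) (e i) v →
    ∃ λ j → v ≡ e j × Star (StepAvoiding H w) i j
  restrict-avoiding ε = _ , refl , ε
  restrict-avoiding ((a , i≢w , j≢w) ◅ p) with j , refl ← e-closed a
    with k , eq , q ← restrict-avoiding p =
    k , eq , (adj⁻ a , i≢w ∘ cong e , j≢w ∘ cong e) ◅ q

  separated-at : Separated H → ∀ w {x y} → Adj G (e w) x → Adj G (e w) y →
    Star (StepAvoiding G (e w)) x y → x ≡ y
  separated-at sep w wx wy p with i , refl ← e-closed wx with j , refl , q ← restrict-avoiding p =
    cong e (sep w (adj⁻ wx) (adj⁻ wy) q)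

-- Neighbours outside the image can only help. The claim is pointwise because the larger graph also
-- has vertices outside the image.
dominated-image : {H : Graph m} {G : Graph n} {t : Fin m → Bool} {s : Fin n → Bool} (e : Fin m → Fin n) →
  (∀ {i j} → e i ≡ e j → i ≡ j) → (∀ i j → H i j ≡ G (e i) (e j)) → (∀ i → t i ≡ s (e i)) →
  DoublyDominating H t → ∀ i → DominatedAt G s (e i)
dominated-image {H = H} {G} e e-injective e-edges t≗s dd i =
  (λ si → let j , tj , ij = proj₁ (dd i) (trans (t≗s i) si) in e j , image j tj ij) ,
  (λ si → let j , k , j≢k , (tj , ij) , (tk , ik) = proj₂ (dd i) (trans (t≗s i) si)
          in e j , e k , j≢k ∘ e-injective , image j tj ij , image k tk ik)
  where
  image : ∀ j → _ → Adj H i j → _ × Adj G (e i) (e j)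
  image j tj ij = trans (sym (t≗s j)) tj , trans (sym (e-edges i j)) ij

data Side (m k : ℕ) : Fin (m + k) → Set where
  left  : ∀ i → Side m k (i ↑ˡ k)
  right : ∀ j → Side m k (m ↑ʳ j)

side : ∀ m k v → Side m k v
side m k v with splitAt m v | join-splitAt m k v
... | inj₁ i | refl = left i
... | inj₂ j | refl = right j

module _ (F : Graph m) (H : Graph k) where

  ⊕-edgesˡ : ∀ i j → F i j ≡ (F ⊕ H) (i ↑ˡ k) (j ↑ˡ k)
  ⊕-edgesˡ i j rewrite splitAt-↑ˡ m i k | splitAt-↑ˡ m j k = refl

  ⊕-edgesʳ : ∀ i j → H i j ≡ (F ⊕ H) (m ↑ʳ i) (m ↑ʳ j)
  ⊕-edgesʳ i j rewrite splitAt-↑ʳ m k i | splitAt-↑ʳ m k j = refl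

  ⊕-crossˡ : ∀ i j → (F ⊕ H) (i ↑ˡ k) (m ↑ʳ j) ≡ false
  ⊕-crossˡ i j rewrite splitAt-↑ˡ m i k | splitAt-↑ʳ m k j = refl

  ⊕-crossʳ : ∀ i j → (F ⊕ H) (m ↑ʳ j) (i ↑ˡ k) ≡ false
  ⊕-crossʳ i j rewrite splitAt-↑ˡ m i k | splitAt-↑ʳ m k j = refl

  ⊕-closedˡ : ∀ {i v} → Adj (F ⊕ H) (i ↑ˡ k) v → ∃ λ j → v ≡ j ↑ˡ k
  ⊕-closedˡ {i} {v} iv with side m k v
  ... | left j  = j , refl
  ... | right j = contradiction (trans (sym iv) (⊕-crossˡ i j)) λ ()

  ⊕-closedʳ : ∀ {i v} → Adj (F ⊕ H) (m ↑ʳ i) v → ∃ λ j → v ≡ m ↑ʳ j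
  ⊕-closedʳ {i} {v} iv with side m k v
  ... | left j  = contradiction (trans (sym iv) (⊕-crossʳ j i)) λ ()
  ... | right j = j , refl

  module ⊕ˡ = ComponentEmbedding {H = F} {F ⊕ H} (_↑ˡ k) (↑ˡ-injective k _ _) ⊕-edgesˡ ⊕-closedˡ
  module ⊕ʳ = ComponentEmbedding {H = H} {F ⊕ H} (m ↑ʳ_) (↑ʳ-injective m _ _) ⊕-edgesʳ ⊕-closedʳ

⊎ᵇ-↑ˡ : (N : Fin m → Bool) (M : Fin k → Bool) → ∀ i → (N ⊎ᵇ M) (i ↑ˡ k) ≡ N i
⊎ᵇ-↑ˡ {m} {k} N M i = cong [ N , M ] (splitAt-↑ˡ m i k)

⊎ᵇ-↑ʳ : (N : Fin m → Bool) (M : Fin k → Bool) → ∀ j → (N ⊎ᵇ M) (m ↑ʳ j) ≡ M j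
⊎ᵇ-↑ʳ {m} {k} N M j = cong [ N , M ] (splitAt-↑ʳ m k j)

-- The forests to which a new vertex with neighbourhood N can be attached so as to get a tree.
record Attachable (F : Graph m) (N : Fin m → Bool) : Set where
  field
    simple    : IsSimple F
    separated : Separated F
    reach     : ∀ v → ∃ λ x → N x ≡ true × Star (Adj F) v x
    unique    : ∀ {x y} → N x ≡ true → N y ≡ true → Star (Adj F) x y → x ≡ y

⌊⌋⇒≡ : {u v : Fin n} → ⌊ u ≟ v ⌋ ≡ true → u ≡ v
⌊⌋⇒≡ {u = u} {v} _ with yes u≡v ← u ≟ v = u≡v

single-refl : (x : Fin n) → single x x ≡ true
single-refl x with x ≟ x
... | yes _  = refl
... | no x≢x = contradiction refl x≢x

single-attachable : {T : Graph n} → IsSeparatedTree T → (x : Fin n) → Attachable T (single x)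
single-attachable (simple , conn , sep) x = record
  { simple = simple ; separated = sep ; reach = λ v → x , single-refl x , conn v x
  ; unique = λ Nu Nv _ → trans (⌊⌋⇒≡ Nu) (sym (⌊⌋⇒≡ Nv)) }

-- `reach` and `unique` say together that the neighbourhood meets every component exactly once.
-- Disjoint unions preserve this, so two and three trees are treated alike.
⊕-attachable : {F : Graph m} {H : Graph k} {N : Fin m → Bool} {M : Fin k → Bool} →
  Attachable F N → Attachable H M → Attachable (F ⊕ H) (N ⊎ᵇ M)
⊕-attachable {m} {k} {F} {H} {N} {M} A B = record
  { simple = symmetric , irreflexive ; separated = separated ; reach = reach ; unique = unique }
  where
  module A = Attachable A
  module B = Attachable B
  module L = ⊕ˡ F H
  module R = ⊕ʳ F H
  Nˡ : ∀ {i} → (N ⊎ᵇ M) (i ↑ˡ k) ≡ true → N i ≡ true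
  Nˡ = trans (sym (⊎ᵇ-↑ˡ N M _))
  Nʳ : ∀ {i} → (N ⊎ᵇ M) (m ↑ʳ i) ≡ true → M i ≡ true
  Nʳ = trans (sym (⊎ᵇ-↑ʳ N M _))
  symmetric : ∀ u v → (F ⊕ H) u v ≡ (F ⊕ H) v u
  symmetric u v with side m k u | side m k v
  ... | left i  | left j  = trans (sym (⊕-edgesˡ F H i j)) (trans (proj₁ A.simple i j) (⊕-edgesˡ F H j i))
  ... | left i  | right j = trans (⊕-crossˡ F H i j) (sym (⊕-crossʳ F H i j))
  ... | right i | left j  = trans (⊕-crossʳ F H j i) (sym (⊕-crossˡ F H j i))
  ... | right i | right j = trans (sym (⊕-edgesʳ F H i j)) (trans (proj₁ B.simple i j) (⊕-edgesʳ F H j i))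
  irreflexive : ∀ v → (F ⊕ H) v v ≡ false
  irreflexive v with side m k v
  ... | left i  = trans (sym (⊕-edgesˡ F H i i)) (proj₂ A.simple i)
  ... | right i = trans (sym (⊕-edgesʳ F H i i)) (proj₂ B.simple i)
  separated : Separated (F ⊕ H)
  separated w with side m k w
  ... | left i  = L.separated-at A.separated i
  ... | right i = R.separated-at B.separated i
  reach : ∀ v → ∃ λ x → (N ⊎ᵇ M) x ≡ true × Star (Adj (F ⊕ H)) v x
  reach v with side m k v
  ... | left i  = let x , Nx , p = A.reach i in x ↑ˡ k , trans (⊎ᵇ-↑ˡ N M x) Nx , Star.gmap (_↑ˡ k) L.adj⁺ p
  ... | right i = let x , Mx , p = B.reach i in m ↑ʳ x , trans (⊎ᵇ-↑ʳ N M x) Mx , Star.gmap (m ↑ʳ_) R.adj⁺ p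
  unique : ∀ {x y} → (N ⊎ᵇ M) x ≡ true → (N ⊎ᵇ M) y ≡ true → Star (Adj (F ⊕ H)) x y → x ≡ y
  unique {x} Nx Ny p with side m k x
  ... | left i  with j , refl , q ← L.restrict p = cong (_↑ˡ k) (A.unique (Nˡ Nx) (Nˡ Ny) q)
  ... | right i with j , refl , q ← R.restrict p = cong (m ↑ʳ_) (B.unique (Nʳ Nx) (Nʳ Ny) q)

⊕-dominating : {F : Graph m} {H : Graph k} (S : Subset m) (S′ : Subset k) →
  DoublyDominating F (lookup S) → DoublyDominating H (lookup S′) →
  DoublyDominating (F ⊕ H) (lookup (S ++ S′))
⊕-dominating {m} {k} {F} {H} S S′ d d′ v with side m k v
... | left i  = dominated-image {G = F ⊕ H} {s = lookup (S ++ S′)} (_↑ˡ k) (↑ˡ-injective k _ _) (⊕-edgesˡ F H)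
                  (λ i → sym (lookup-++ˡ S S′ i)) d i
... | right i = dominated-image {G = F ⊕ H} {s = lookup (S ++ S′)} (m ↑ʳ_) (↑ʳ-injective m _ _) (⊕-edgesʳ F H)
                  (λ i → sym (lookup-++ʳ S S′ i)) d′ i

attach : {F : Graph m} {N : Fin m → Bool} → Attachable F N → IsSeparatedTree (addVertex F N)
attach {m} {F} {N} A = simple , connected , separated
  where
  module A = Attachable A
  module F = Simple A.simple
  G = addVertex F N
  simple : IsSimple G
  simple = (λ { zero zero → refl ; zero (suc _) → refl ; (suc _) zero → refl
              ; (suc i) (suc j) → proj₁ A.simple i j })
         , (λ { zero → refl ; (suc i) → proj₂ A.simple i })
  module G = Simple simple
  to-new : ∀ v → Star (Adj G) v zero
  to-new zero    = ε
  to-new (suc v) = let x , Nx , p = A.reach v in Star.gmap suc (λ e → e) p ◅◅ (Nx ◅ ε)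
  connected : ∀ u v → Star (Adj G) u v
  connected u v = to-new u ◅◅ Star.reverse (λ {x} {y} → G.adj-sym {x} {y}) (to-new v)
  forget : ∀ {w x y} → Star (StepAvoiding F w) x y → Star (Adj F) x y
  forget = Star.map proj₁
  end≢ : ∀ {w x y} → x ≢ w → Star (StepAvoiding F w) x y → y ≢ w
  end≢ x≢w ε = x≢w
  end≢ _ ((_ , _ , v≢w) ◅ p) = end≢ v≢w p
  below : ∀ {x y} → Star (StepAvoiding G zero) (suc x) (suc y) → Star (Adj F) x y
  below ε = ε
  below (_◅_ {j = zero}  (_ , _ , 0≢0) p) = contradiction refl 0≢0
  below (_◅_ {j = suc _} (e , _) p)       = e ◅ below p
  Escape : Fin m → Fin m → Set
  Escape w x = ∃ λ a → N a ≡ true × Star (StepAvoiding F w) x a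
  -- Follow the walk up to its first visit to the new vertex: the vertex just before it lies in `N`.
  escape : ∀ {w x v} → Star (StepAvoiding G (suc w)) (suc x) v →
    (∃ λ y → v ≡ suc y × Star (StepAvoiding F w) x y) ⊎ Escape w x
  escape ε = inj₁ (_ , refl , ε)
  escape {x = x} (_◅_ {j = zero} (Nx , _) p) = inj₂ (x , Nx , ε)
  escape (_◅_ {j = suc _} (e , x≢w , y≢w) p)
    with e′ ← (e , x≢w ∘ cong suc , y≢w ∘ cong suc) | escape p
  ... | inj₁ (y , eq , q) = inj₁ (y , eq , e′ ◅ q)
  ... | inj₂ (a , Na , q) = inj₂ (a , Na , e′ ◅ q)
  -- Here `w` is the only vertex of `N` in its component, and the walk avoids it.
  no-escape : ∀ {w x} → N w ≡ true → Adj F w x → ¬ Escape w x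
  no-escape Nw wx (a , Na , p) =
    end≢ (≢-sym (F.adj⇒≢ wx)) p (sym (A.unique Nw Na (wx ◅ forget p)))
  separated : Separated G
  separated zero {suc x} {suc y} Nx Ny p = cong suc (A.unique Nx Ny (below p))
  separated (suc w) {zero} {zero} _ _ _ = refl
  separated (suc w) {suc x} {zero} wx Nw p with escape p
  ... | inj₂ esc = contradiction esc (no-escape Nw wx)
  separated (suc w) {zero} {suc y} Nw wy p with escape (G.reverse-avoiding p)
  ... | inj₂ esc = contradiction esc (no-escape Nw wy)
  separated (suc w) {suc x} {suc y} wx wy p with escape p | escape (G.reverse-avoiding p)
  ... | inj₁ (_ , refl , q) | _ = cong suc (A.separated w wx wy q)
  ... | _ | inj₁ (_ , refl , q) = cong suc (sym (A.separated w wy wx q))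
  -- Both ends reach the new vertex. Through w, the vertices a and b share a component, so they are
  -- equal and the excursion can be short-cut inside `F`.
  ... | inj₂ (a , Na , q) | inj₂ (b , Nb , r)
    with refl ← A.unique Na Nb (Star.reverse F.adj-sym (forget q) ◅◅ (F.adj-sym wx ◅ wy ◅ forget r)) =
    cong suc (A.separated w wx wy (q ◅◅ F.reverse-avoiding r))

ChosenPair : (Fin n → Bool) → Subset n → Set
ChosenPair N S = ∃₂ λ x y → x ≢ y × (lookup S x ≡ true × N x ≡ true) × (lookup S y ≡ true × N y ≡ true)

attach-dominating : {F : Graph m} {N : Fin m → Bool} {S : Subset m} → DoublyDominating F (lookup S) →
  ChosenPair N S →
  DoublyDominating (addVertex F N) (lookup (false ∷ S))
attach-dominating dd (x , y , x≢y , Nx , Ny) zero =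
  (λ ()) , λ _ → suc x , suc y , x≢y ∘ suc-injective , Nx , Ny
attach-dominating {N = N} {S} dd _ (suc i) =
  dominated-image {G = addVertex _ N} {s = lookup (false ∷ S)} suc suc-injective (λ _ _ → refl) (λ _ → refl) dd i

-- The bound 2m + 6 is 2(m + 1) + 4 in terms of the m old vertices; the new vertex stays out of the
-- set.
attach-tight : {F : Graph m} {N : Fin m → Bool} (S : Subset m) → Attachable F N → DoublyDominating F (lookup S) →
  ChosenPair N S →
  3 * ∣ S ∣ ≤ 2 * m + 6 → Tight (addVertex F N) (false ∷ S)
attach-tight {m} S A dd two@(x , y , x≢y , _) small =
  tight (attach A) (m≤n⇒m≤1+n (two-members⇒2≤n x≢y)) (attach-dominating {S = S} dd two)
    (≤-trans small (≤-reflexive (shift m)))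
  where
  shift : ∀ m → 2 * m + 6 ≡ 2 * suc m + 4
  shift = solve-∀

lookup-∩-tabulate : (N : Fin n → Bool) (S : Subset n) → ∀ v → lookup (tabulate N ∩ S) v ≡ N v ∧ lookup S v
lookup-∩-tabulate N S v =
  trans (lookup-zipWith _∧_ v (tabulate N) S) (cong (_∧ lookup S v) (lookup∘tabulate N v))

two-chosen : (N : Fin n → Bool) (S : Subset n) → 2 ≤ ∣ tabulate N ∩ S ∣ → ChosenPair N S
two-chosen N S 2≤ with x , y , x≢y , Nx , Ny ← 1<#⇒members _ (subst (2 ≤_) (∣p∣≡#lookup (tabulate N ∩ S)) 2≤) =
  x , y , x≢y , split Nx , split Ny
  where
  split : ∀ {v} → lookup (tabulate N ∩ S) v ≡ true → lookup S v ≡ true × N v ≡ true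
  split {v} eq with both ← trans (sym (lookup-∩-tabulate N S v)) eq =
    ∧-conicalʳ _ _ both , ∧-conicalˡ _ _ both

chosen-two : (N : Fin n → Bool) (S : Subset n) → ChosenPair N S → 2 ≤ ∣ tabulate N ∩ S ∣
chosen-two N S (x , y , x≢y , Nx , Ny) = subst (2 ≤_) (sym (∣p∣≡#lookup (tabulate N ∩ S)))
  (length≤# ((x≢y ∷ []) ∷ [] ∷ []) (both Nx ∷ both Ny ∷ []))
  where
  both : ∀ {v} → lookup S v ≡ true × N v ≡ true → lookup (tabulate N ∩ S) v ≡ true
  both {v} (Sv , Nv) = trans (lookup-∩-tabulate N S v) (cong₂ _∧_ Nv Sv)

-- Isomorphisms and small trees

infix 4 _≅_

-- Unlike `Iso`, this allows two expressions for the order, such as `suc (n₁ + n₂)` and `n`; the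
-- bijection itself yields their equality when `iso` has to be applied.
record _≅_ (G : Graph m) (H : Graph n) : Set where
  constructor _,_
  field
    bijection : Fin m ↔ Fin n
    preserves : ∀ u v → G u v ≡ H (Inverse.to bijection u) (Inverse.to bijection v)

module _ {m n} {G : Graph m} {H : Graph n} (iso : G ≅ H) where
  open _≅_ iso renaming (bijection to f)
  open Inverse f using (to; from; strictlyInverseˡ; strictlyInverseʳ)

  to-injective : ∀ {u v} → to u ≡ to v → u ≡ v
  to-injective {u} {v} eq = trans (sym (strictlyInverseʳ u)) (trans (cong from eq) (strictlyInverseʳ v))

  ≅-sym : H ≅ G
  ≅-sym = ↔-sym f , λ u v → trans (sym (cong₂ H (strictlyInverseˡ u) (strictlyInverseˡ v)))
                                  (sym (preserves (from u) (from v)))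

  ≅-trans : {K : Graph k} → H ≅ K → G ≅ K
  ≅-trans (g , eq) = ↔-trans f g , λ u v → trans (preserves u v) (eq (to u) (to v))

  ≅-tree : IsSeparatedTree G → IsSeparatedTree H
  ≅-tree (simple , conn , sep) =
    E.isSimple simple ,
    (λ u v → subst₂ (Star (Adj H)) (strictlyInverseˡ u) (strictlyInverseˡ v)
      (Star.gmap to (λ {a} {b} e → trans (sym (preserves a b)) e) (conn (from u) (from v)))) ,
    E.separated sep
    where
    from-injective : ∀ {u v} → from u ≡ from v → u ≡ v
    from-injective {u} {v} eq = trans (sym (strictlyInverseˡ u)) (trans (cong to eq) (strictlyInverseˡ v))
    module E = Embedding {H = H} {G} from from-injective (_≅_.preserves ≅-sym)

  image : Subset m → Subset n
  image S = tabulate (lookup S ∘ from)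

  lookup-image : ∀ S v → lookup S v ≡ lookup (image S) (to v)
  lookup-image S v = sym (trans (lookup∘tabulate _ (to v)) (cong (lookup S) (strictlyInverseʳ v)))

  ∣image∣ : ∀ S → ∣ S ∣ ≡ ∣ image S ∣
  ∣image∣ S = begin
    ∣ S ∣                         ≡⟨ ∣p∣≡#lookup S ⟩
    # (lookup S)                  ≡⟨ #-cong (lookup-image S) ⟩
    # (lookup (image S) ∘ to)     ≡⟨ sum-permute _ f ⟨
    # (lookup (image S))          ≡⟨ ∣p∣≡#lookup (image S) ⟨
    ∣ image S ∣                   ∎
    where open ≡-Reasoning

  ≅-tight : {S : Subset m} → Tight G S → Tight H (image S)
  ≅-tight {S} (tight tree 2≤n dd small) with refl ← ↔⇒≡ f =
    tight (≅-tree tree) 2≤n dominating (subst (λ c → 3 * c ≤ 2 * n + 4) (∣image∣ S) small)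
    where
    dominating : DoublyDominating H (lookup (image S))
    dominating v = subst (DominatedAt H (lookup (image S))) (strictlyInverseˡ v)
      (dominated-image {G = H} {s = lookup (image S)} to to-injective preserves (lookup-image S) dd (from v))

≅-𝓕 : {G : Graph m} {H : Graph n} → G ≅ H → 𝓕 m G → 𝓕 n H
≅-𝓕 (f , edges) d with refl ← ↔⇒≡ f = iso d (f , edges)

lift-≅ : {T : Graph m} {U : Graph n} (i : T ≅ U) → ∀ x →
  addVertex T (single x) ≅ addVertex U (single (Inverse.to (_≅_.bijection i) x))
lift-≅ {T = T} {U} i@(f , edges) x = lift₀ f , λ
  { zero    zero    → refl
  ; zero    (suc v) → neighbour v
  ; (suc u) zero    → neighbour u
  ; (suc u) (suc v) → edges u v }
  where
  neighbour : ∀ v → single x v ≡ single (Inverse.to f x) (Inverse.to f v)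
  neighbour v with v ≟ x | Inverse.to f v ≟ Inverse.to f x
  ... | yes _    | yes _  = refl
  ... | yes refl | no neq = contradiction refl neq
  ... | no  neq  | yes eq = contradiction (to-injective i eq) neq
  ... | no  _    | no  _  = refl

permutation-≅ : {G : Graph m} (H : Graph n) (f : Fin m ↔ Fin n) →
  {True (all? λ u → all? λ v → G u v Bool.≟ H (Inverse.to f u) (Inverse.to f v))} → G ≅ H
permutation-≅ _ f {w} = f , toWitness w

-- Small trees are grown from one vertex by adding leaves. The isomorphisms that follow serve both
-- to see that the base graphs are trees and to classify trees of order at most four.
K1 : Graph 1
K1 _ _ = false

K1⁺≅P2 : addVertex K1 (single 0F) ≅ P2
K1⁺≅P2 = permutation-≅ P2 idₚ

P2⁺0≅P3 : addVertex P2 (single 0F) ≅ P3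
P2⁺0≅P3 = permutation-≅ P3 idₚ

P2⁺1≅P3 : addVertex P2 (single 1F) ≅ P3
P2⁺1≅P3 = permutation-≅ P3 (transpose 1F 2F)

P3⁺0≅P4 : addVertex P3 (single 0F) ≅ P4
P3⁺0≅P4 = permutation-≅ P4 idₚ

P3⁺1≅K13 : addVertex P3 (single 1F) ≅ K13
P3⁺1≅K13 = permutation-≅ K13 (transpose 0F 2F)

P3⁺2≅P4 : addVertex P3 (single 2F) ≅ P4
P3⁺2≅P4 = permutation-≅ P4 (transpose 1F 3F)

add-leaf : {T : Graph n} → IsSeparatedTree T → ∀ x → IsSeparatedTree (addVertex T (single x))
add-leaf tree x = attach (single-attachable tree x)

K1-tree : IsSeparatedTree K1
K1-tree = ((λ _ _ → refl) , λ _ → refl) , (λ { 0F 0F → ε }) , λ _ ()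

P2-tree : IsSeparatedTree P2
P2-tree = ≅-tree K1⁺≅P2 (add-leaf K1-tree 0F)

P3-tree : IsSeparatedTree P3
P3-tree = ≅-tree P2⁺0≅P3 (add-leaf P2-tree 0F)

P4-tree : IsSeparatedTree P4
P4-tree = ≅-tree P3⁺0≅P4 (add-leaf P3-tree 0F)

K13-tree : IsSeparatedTree K13
K13-tree = ≅-tree P3⁺1≅K13 (add-leaf P3-tree 1F)

star⇒neighbour : {G : Graph n} {u v : Fin n} → Star (Adj G) u v → u ≢ v → ∃ (Adj G u)
star⇒neighbour ε       u≢u = contradiction refl u≢u
star⇒neighbour (e ◅ _) _   = _ , e

other-vertex : 2 ≤ n → (v : Fin n) → ∃ λ u → v ≢ u
other-vertex (s≤s (s≤s _)) zero    = 1F , λ ()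
other-vertex (s≤s (s≤s _)) (suc _) = 0F , λ ()

small-tight : {G : Graph n} → IsSeparatedTree G → 2 ≤ n → n ≤ 4 → Tight G ⊤
small-tight {n} tree@(_ , conn , _) 2≤n n≤4 = tight tree 2≤n
  (λ v → (λ _ → let u , v≢u = other-vertex 2≤n v
                    t , vt  = star⇒neighbour (conn v u) v≢u
                in t , lookup-replicate t true , vt)
       , λ eq → contradiction (trans (sym (lookup-replicate v true)) eq) λ ())
  (begin
    3 * ∣ ⊤ {n} ∣  ≡⟨ cong (3 *_) (∣⊤∣≡n n) ⟩
    3 * n          ≡⟨ +-comm n (2 * n) ⟩
    2 * n + n      ≤⟨ +-monoʳ-≤ (2 * n) n≤4 ⟩
    2 * n + 4      ∎)
  where open ≤-Reasoning

small-TMin : {G : Graph n} → IsSeparatedTree G → {True (2 ≤? n)} → {True (n ≤? 4)} → TMin n G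
small-TMin tree {p} {q} = tight⇒TMin (small-tight tree (toWitness p) (toWitness q))

-- The operations preserve optimality

single-pair : (x₁ : Fin n₁) (x₂ : Fin n₂) → x₁ ∈ S₁ → x₂ ∈ S₂ →
  ChosenPair (single x₁ ⊎ᵇ single x₂) (S₁ ++ S₂)
single-pair {n₁} {n₂} {S₁} {S₂} x₁ x₂ x₁∈ x₂∈ =
  x₁ ↑ˡ n₂ , n₁ ↑ʳ x₂ , left≢right ,
  (trans (lookup-++ˡ S₁ S₂ x₁) ([]=⇒lookup x₁∈) , trans (⊎ᵇ-↑ˡ (single x₁) (single x₂) x₁) (single-refl x₁)) ,
  (trans (lookup-++ʳ S₁ S₂ x₂) ([]=⇒lookup x₂∈) , trans (⊎ᵇ-↑ʳ (single x₁) (single x₂) x₂) (single-refl x₂))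
  where
  left≢right : x₁ ↑ˡ n₂ ≢ n₁ ↑ʳ x₂
  left≢right eq with () ← trans (sym (splitAt-↑ˡ n₁ x₁ n₂)) (trans (cong (splitAt n₁) eq) (splitAt-↑ʳ n₁ n₂ x₂))

-- Of the two constants 2 one is used up by the new vertex, so the excess of the new tree is r₁ +
-- r₂.
attach₂ : Tight T₁ S₁ → Tight T₂ S₂ → (x₁ : Fin n₁) (x₂ : Fin n₂) →
  ChosenPair (single x₁ ⊎ᵇ single x₂) (S₁ ++ S₂) →
  ∀ r₁ r₂ → Excess n₁ S₁ r₁ → Excess n₂ S₂ r₂ → r₁ + r₂ ≤ 2 →
  TMin (suc (n₁ + n₂)) (addVertex (T₁ ⊕ T₂) (single x₁ ⊎ᵇ single x₂))
attach₂ {n₁} {S₁ = S₁} {n₂} {S₂ = S₂} t₁ t₂ x₁ x₂ pair r₁ r₂ e₁ e₂ r≤2 =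
  tight⇒TMin (attach-tight (S₁ ++ S₂)
    (⊕-attachable (single-attachable (Tight.tree t₁) x₁) (single-attachable (Tight.tree t₂) x₂))
    (⊕-dominating S₁ S₂ (Tight.dominating t₁) (Tight.dominating t₂)) pair (begin
      3 * ∣ S₁ ++ S₂ ∣                        ≡⟨ cong (3 *_) (∣++∣ S₁ S₂) ⟩
      3 * (∣ S₁ ∣ + ∣ S₂ ∣)                   ≡⟨ *-distribˡ-+ 3 (∣ S₁ ∣) (∣ S₂ ∣) ⟩
      3 * ∣ S₁ ∣ + 3 * ∣ S₂ ∣                 ≡⟨ cong₂ _+_ e₁ e₂ ⟩
      2 * n₁ + 2 + r₁ + (2 * n₂ + 2 + r₂)     ≡⟨ regroup n₁ n₂ r₁ r₂ ⟩
      2 * (n₁ + n₂) + 4 + (r₁ + r₂)           ≤⟨ +-monoʳ-≤ (2 * (n₁ + n₂) + 4) r≤2 ⟩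
      2 * (n₁ + n₂) + 4 + 2                   ≡⟨ +-assoc (2 * (n₁ + n₂)) 4 2 ⟩
      2 * (n₁ + n₂) + 6                       ∎))
  where
  open ≤-Reasoning
  regroup : ∀ n₁ n₂ r₁ r₂ → 2 * n₁ + 2 + r₁ + (2 * n₂ + 2 + r₂) ≡ 2 * (n₁ + n₂) + 4 + (r₁ + r₂)
  regroup = solve-∀

-- `ChosenPair` leaves open which two attaching vertices are chosen: the third may lie outside its
-- set.
attach₃ : Tight T₁ S₁ → Tight T₂ S₂ → Tight T₃ S₃ → (x₁ : Fin n₁) (x₂ : Fin n₂) (x₃ : Fin n₃) →
  ChosenPair ((single x₁ ⊎ᵇ single x₂) ⊎ᵇ single x₃) ((S₁ ++ S₂) ++ S₃) →
  Excess n₁ S₁ 0 → Excess n₂ S₂ 0 → Excess n₃ S₃ 0 →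
  TMin (suc ((n₁ + n₂) + n₃)) (addVertex ((T₁ ⊕ T₂) ⊕ T₃) ((single x₁ ⊎ᵇ single x₂) ⊎ᵇ single x₃))
attach₃ {n₁} {S₁ = S₁} {n₂} {S₂ = S₂} {n₃} {S₃ = S₃} t₁ t₂ t₃ x₁ x₂ x₃ pair e₁ e₂ e₃ =
  tight⇒TMin (attach-tight ((S₁ ++ S₂) ++ S₃)
    (⊕-attachable (⊕-attachable (single-attachable (Tight.tree t₁) x₁) (single-attachable (Tight.tree t₂) x₂))
                  (single-attachable (Tight.tree t₃) x₃))
    (⊕-dominating (S₁ ++ S₂) S₃ (⊕-dominating S₁ S₂ (Tight.dominating t₁) (Tight.dominating t₂)) (Tight.dominating t₃))
    pair (≤-reflexive (begin
      3 * ∣ (S₁ ++ S₂) ++ S₃ ∣                             ≡⟨ cong (3 *_) (trans (∣++∣ (S₁ ++ S₂) S₃) (cong (_+ ∣ S₃ ∣) (∣++∣ S₁ S₂))) ⟩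
      3 * (∣ S₁ ∣ + ∣ S₂ ∣ + ∣ S₃ ∣)                       ≡⟨ distribute (∣ S₁ ∣) (∣ S₂ ∣) (∣ S₃ ∣) ⟩
      3 * ∣ S₁ ∣ + 3 * ∣ S₂ ∣ + 3 * ∣ S₃ ∣                 ≡⟨ cong₂ _+_ (cong₂ _+_ e₁ e₂) e₃ ⟩
      2 * n₁ + 2 + 0 + (2 * n₂ + 2 + 0) + (2 * n₃ + 2 + 0) ≡⟨ regroup n₁ n₂ n₃ ⟩
      2 * (n₁ + n₂ + n₃) + 6                               ∎)))
  where
  open ≡-Reasoning
  distribute : ∀ a b c → 3 * (a + b + c) ≡ 3 * a + 3 * b + 3 * c
  distribute = solve-∀
  regroup : ∀ a b c → 2 * a + 2 + 0 + (2 * b + 2 + 0) + (2 * c + 2 + 0) ≡ 2 * (a + b + c) + 6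
  regroup = solve-∀

𝓕⇒TMin : {G : Graph n} → 𝓕 n G → TMin n G
𝓕⇒TMin base-P2  = small-TMin P2-tree
𝓕⇒TMin base-P3  = small-TMin P3-tree
𝓕⇒TMin base-P4  = small-TMin P4-tree
𝓕⇒TMin base-K13 = small-TMin K13-tree
𝓕⇒TMin (iso d (f , edges)) = tight⇒TMin (≅-tight (f , edges) (proj₂ (TMin⇒tight (𝓕⇒TMin d))))
𝓕⇒TMin (op-a _ m₁ _ m₂ c₁ c₂ S₁ S₂ min₁ min₂ w₁ w₂ w₁∈ w₂∈) =
  attach₂ t₁ t₂ w₁ w₂ (single-pair w₁ w₂ w₁∈ w₂∈) 0 0 (excess-0 t₁ c₁) (excess-0 t₂ c₂) z≤n
  where
  t₁ = min⇒tight m₁ min₁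
  t₂ = min⇒tight m₂ min₂
𝓕⇒TMin (op-b _ m₁ _ m₂ c₁ c₂ S₁ S₂ min₁ min₂ w₁ w₂ w₁∈ w₂∈) =
  attach₂ t₁ t₂ w₁ w₂ (single-pair w₁ w₂ w₁∈ w₂∈) 1 0 (excess-1 t₁ c₁) (excess-0 t₂ c₂) (s≤s z≤n)
  where
  t₁ = min⇒tight m₁ min₁
  t₂ = min⇒tight m₂ min₂
𝓕⇒TMin (op-c2 _ m₁ _ m₂ (inj₁ (c₁ , c₂)) S₁ S₂ min₁ min₂ x₁ x₂ 2≤) =
  attach₂ t₁ t₂ x₁ x₂ (two-chosen _ _ 2≤) 1 1 (excess-1 t₁ c₁) (excess-1 t₂ c₂) ≤-refl
  where
  t₁ = min⇒tight m₁ min₁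
  t₂ = min⇒tight m₂ min₂
-- The second tree has excess 0, so the whole allowance of 2 is left to the first.
𝓕⇒TMin (op-c2 _ m₁ _ m₂ (inj₂ (_ , c₂)) S₁ S₂ min₁ min₂ x₁ x₂ 2≤) =
  let r , r≤2 , e₁ = excess t₁
  in attach₂ t₁ t₂ x₁ x₂ (two-chosen _ _ 2≤) r 0 e₁ (excess-0 t₂ c₂) (≤-trans (≤-reflexive (+-identityʳ r)) r≤2)
  where
  t₁ = min⇒tight m₁ min₁
  t₂ = min⇒tight m₂ min₂
𝓕⇒TMin (op-c3 _ m₁ _ m₂ _ m₃ c₁ c₂ c₃ S₁ S₂ S₃ min₁ min₂ min₃ x₁ x₂ x₃ 2≤) =
  attach₃ t₁ t₂ t₃ x₁ x₂ x₃ (two-chosen _ _ 2≤) (excess-0 t₁ c₁) (excess-0 t₂ c₂) (excess-0 t₃ c₃)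
  where
  t₁ = min⇒tight m₁ min₁
  t₂ = min⇒tight m₂ min₂
  t₃ = min⇒tight m₃ min₃

-- Reassembling a tree from its branches

module Assembly {G : Graph n} (tree : IsSeparatedTree G) (w : Fin n) (S : Subset n) where
  open Simple (proj₁ tree)
  open Branches tree w

  -- A set of branches at w (those whose head satisfies P), presented as a graph H,
  -- with the neighbours N of w and the part R of S in it.
  record Piece (P : Fin n → Set) (H : Graph m) (N : Fin m → Bool) (R : Subset m) : Set where
    field
      at        : Fin m → Fin n
      injective : ∀ {i j} → at i ≡ at j → i ≡ j
      at≢w      : ∀ i → at i ≢ w
      heads     : ∀ i → P (branch (at i))
      onto      : ∀ v → P (branch v) → ∃ λ i → at i ≡ v
      edges     : ∀ i j → H i j ≡ G (at i) (at j)
      nbrs      : ∀ i → N i ≡ G w (at i)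
      chosen    : ∀ i → lookup R i ≡ lookup S (at i)

  module _ {x : Fin n} (wx : Adj G w x) where
    private module B = Branch wx

    branchSet : Subset B.size
    branchSet = tabulate (lookup S ∘ B.at)

    branch-piece : Piece (_≡ x) B.subtree (single B.root) branchSet
    branch-piece = record
      { at = B.at ; injective = B.injective ; at≢w = B.at≢w ; heads = B.branch-at
      ; onto = λ v → B.onto′ {v} ; edges = λ _ _ → refl ; nbrs = nbrs
      ; chosen = lookup∘tabulate _ }
      where
      nbrs : ∀ i → single B.root i ≡ G w (B.at i)
      nbrs i with i ≟ B.root
      ... | yes refl = sym (trans (cong (G w) B.at-root) wx)
      -- A neighbour of w heads its own branch, so inside this branch it can only be the root.
      ... | no  i≢   = sym (¬-not λ wi → i≢ (B.injective
                         (trans (sym (branch-neighbour wi)) (trans (B.branch-at i) (sym B.at-root)))))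

    branchSet-dominating : lookup S w ≡ false → DoublyDominating G (lookup S) →
      DoublyDominating B.subtree (lookup branchSet)
    branchSet-dominating Sw dd i = dominated-image {s = lookup branchSet} (λ i → i) (λ eq → eq) (λ _ _ → refl)
      (λ i → sym (lookup∘tabulate _ i)) (B.doublyDominating {lookup S} Sw dd) i

    root-chosen : lookup S x ≡ true → B.root ∈ branchSet
    root-chosen Sx = lookup⇒[]= B.root branchSet
      (trans (lookup∘tabulate _ B.root) (trans (cong (lookup S) B.at-root) Sx))

  ⊕-piece : {P Q : Fin n → Set} {F : Graph m} {H : Graph k} {N : Fin m → Bool} {M : Fin k → Bool}
    {R : Subset m} {R′ : Subset k} → Piece P F N R → Piece Q H M R′ → (∀ {x} → P x → Q x → ⊥) →
    Piece (λ x → P x ⊎ Q x) (F ⊕ H) (N ⊎ᵇ M) (R ++ R′)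
  ⊕-piece {m} {k} {P} {Q} {F} {H} {N} {M} {R} {R′} A B disjoint = record
    { at = at ; injective = injective ; at≢w = at≢w ; heads = heads ; onto = onto
    ; edges = edges ; nbrs = nbrs ; chosen = chosen }
    where
    module A = Piece A
    module B = Piece B
    at : Fin (m + k) → Fin n
    at = [ A.at , B.at ]′ ∘ splitAt m
    atˡ : ∀ i → at (i ↑ˡ k) ≡ A.at i
    atˡ i = cong [ A.at , B.at ]′ (splitAt-↑ˡ m i k)
    atʳ : ∀ i → at (m ↑ʳ i) ≡ B.at i
    atʳ i = cong [ A.at , B.at ]′ (splitAt-↑ʳ m k i)
    cross : ∀ i j → branch (A.at i) ≢ branch (B.at j)
    cross i j eq = disjoint (subst P eq (A.heads i)) (B.heads j)
    injective : ∀ {u v} → at u ≡ at v → u ≡ v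
    injective {u} {v} eq with side m k u | side m k v
    ... | left i  | left j  = cong (_↑ˡ k) (A.injective (trans (sym (atˡ i)) (trans eq (atˡ j))))
    ... | right i | right j = cong (m ↑ʳ_) (B.injective (trans (sym (atʳ i)) (trans eq (atʳ j))))
    ... | left i  | right j = contradiction (cong branch (trans (sym (atˡ i)) (trans eq (atʳ j)))) (cross i j)
    ... | right i | left j  = contradiction (cong branch (trans (sym (atˡ j)) (trans (sym eq) (atʳ i)))) (cross j i)
    at≢w : ∀ u → at u ≢ w
    at≢w u with side m k u
    ... | left i  = subst (_≢ w) (sym (atˡ i)) (A.at≢w i)
    ... | right i = subst (_≢ w) (sym (atʳ i)) (B.at≢w i)
    heads : ∀ u → P (branch (at u)) ⊎ Q (branch (at u))
    heads u with side m k u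
    ... | left i  = inj₁ (subst (P ∘ branch) (sym (atˡ i)) (A.heads i))
    ... | right i = inj₂ (subst (Q ∘ branch) (sym (atʳ i)) (B.heads i))
    onto : ∀ v → P (branch v) ⊎ Q (branch v) → ∃ λ u → at u ≡ v
    onto v (inj₁ p) = let i , eq = A.onto v p in i ↑ˡ k , trans (atˡ i) eq
    onto v (inj₂ q) = let i , eq = B.onto v q in m ↑ʳ i , trans (atʳ i) eq
    cross-edge : ∀ i j → G (A.at i) (B.at j) ≡ false
    cross-edge i j = ¬-not λ ij → cross i j (branch-step ij (A.at≢w i) (B.at≢w j))
    edges : ∀ u v → (F ⊕ H) u v ≡ G (at u) (at v)
    edges u v with side m k u | side m k v
    ... | left i  | left j  = trans (sym (⊕-edgesˡ F H i j)) (trans (A.edges i j) (sym (cong₂ G (atˡ i) (atˡ j))))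
    ... | right i | right j = trans (sym (⊕-edgesʳ F H i j)) (trans (B.edges i j) (sym (cong₂ G (atʳ i) (atʳ j))))
    ... | left i  | right j = trans (⊕-crossˡ F H i j) (sym (trans (cong₂ G (atˡ i) (atʳ j)) (cross-edge i j)))
    ... | right i | left j  = trans (⊕-crossʳ F H j i) (sym (trans (cong₂ G (atʳ i) (atˡ j))
                                (trans (proj₁ (proj₁ tree) _ _) (cross-edge j i))))
    nbrs : ∀ u → (N ⊎ᵇ M) u ≡ G w (at u)
    nbrs u with side m k u
    ... | left i  = trans (⊎ᵇ-↑ˡ N M i) (trans (A.nbrs i) (sym (cong (G w) (atˡ i))))
    ... | right i = trans (⊎ᵇ-↑ʳ N M i) (trans (B.nbrs i) (sym (cong (G w) (atʳ i))))
    chosen : ∀ u → lookup (R ++ R′) u ≡ lookup S (at u)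
    chosen u with side m k u
    ... | left i  = trans (lookup-++ˡ R R′ i) (trans (A.chosen i) (sym (cong (lookup S) (atˡ i))))
    ... | right i = trans (lookup-++ʳ R R′ i) (trans (B.chosen i) (sym (cong (lookup S) (atʳ i))))

  module _ {P : Fin n → Set} {H : Graph m} {N : Fin m → Bool} {R : Subset m}
    (A : Piece P H N R) (all-branches : ∀ {x} → Adj G w x → P x) where
    private
      module A = Piece A
      to : Fin (suc m) → Fin n
      to zero    = w
      to (suc i) = A.at i
      to-inj : ∀ {i j} → to i ≡ to j → i ≡ j
      to-inj {zero}  {zero}  _  = refl
      to-inj {zero}  {suc j} eq = contradiction (sym eq) (A.at≢w j)
      to-inj {suc i} {zero}  eq = contradiction eq (A.at≢w i)
      to-inj {suc i} {suc j} eq = cong suc (A.injective eq)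
      to-onto : ∀ v → ∃ λ i → to i ≡ v
      to-onto v with v ≟ w
      ... | yes refl = zero , refl
      ... | no  v≢w  = let i , eq = A.onto v (all-branches (branch-adj {v} v≢w)) in suc i , eq

    assembly : Fin (suc m) ↔ Fin n
    assembly = ⤖⇒↔ (mk⤖ (to-inj , λ v → let i , eq = to-onto v in i , λ { refl → eq }))

    assembly-≅ : addVertex H N ≅ G
    assembly-≅ = assembly , λ
      { zero    zero    → sym (proj₂ (proj₁ tree) w)
      ; zero    (suc j) → A.nbrs j
      ; (suc i) zero    → trans (A.nbrs i) (proj₁ (proj₁ tree) w (A.at i))
      ; (suc i) (suc j) → A.edges i j }

    assembly-count : lookup S w ≡ false → ∣ S ∣ ≡ ∣ R ∣
    assembly-count Sw = begin
      ∣ S ∣                             ≡⟨ ∣p∣≡#lookup S ⟩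
      # (lookup S)                      ≡⟨ sum-permute _ assembly ⟩
      # (lookup S ∘ to)                 ≡⟨ cong (λ b → ⟦ b ⟧ + # (lookup S ∘ A.at)) Sw ⟩
      # (lookup S ∘ A.at)               ≡⟨ #-cong A.chosen ⟨
      # (lookup R)                      ≡⟨ ∣p∣≡#lookup R ⟨
      ∣ R ∣                             ∎
      where open ≡-Reasoning

    piece-chosen : ∀ {x y} → x ≢ y → Adj G w x → lookup S x ≡ true → Adj G w y → lookup S y ≡ true →
      2 ≤ ∣ tabulate N ∩ R ∣
    piece-chosen {x} {y} x≢y wx Sx wy Sy
      with i , refl ← A.onto x (subst P (sym (branch-neighbour wx)) (all-branches wx))
         | j , refl ← A.onto y (subst P (sym (branch-neighbour wy)) (all-branches wy)) =
      chosen-two N R (i , j , x≢y ∘ cong A.at , (trans (A.chosen i) Sx , trans (A.nbrs i) wx)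
                                             , (trans (A.chosen j) Sy , trans (A.nbrs j) wy))

-- Leaves and the trees on at most four vertices

HasLeafOtherThan : Graph n → Fin n → Set
HasLeafOtherThan G w = ∃₂ λ ℓ y → ℓ ≢ w × Adj G ℓ y × (∀ {z} → Adj G ℓ z → z ≡ y)

-- The prescribed vertex makes the induction work: a leaf of a branch other than its root is not
-- adjacent to w, so it remains a leaf of G.
leaf-exists : ∀ n {G : Graph n} → IsSeparatedTree G → 2 ≤ n → ∀ w → HasLeafOtherThan G w
leaf-exists = <-rec LeafExists find
  where
  LeafExists : ℕ → Set
  LeafExists n = {G : Graph n} → IsSeparatedTree G → 2 ≤ n → ∀ w → HasLeafOtherThan G w
  find : ∀ n → (∀ {m} → m < n → LeafExists m) → LeafExists n
  find n ih {G} tree 2≤n w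
    with v , w≢v ← other-vertex 2≤n w
    with x , wx ← star⇒neighbour (proj₁ (proj₂ tree) w v) w≢v = result
    where
    open Simple (proj₁ tree)
    open Branches tree w
    module B = Branch wx
    result : HasLeafOtherThan G w
    result with 2 ≤? B.size
    ... | no size≱2 = x , w , ≢-sym (adj⇒≢ wx) , adj-sym wx , only
      where
      only : ∀ {z} → Adj G x z → z ≡ w
      only {z} xz with z ≟ w
      ... | yes z≡w = z≡w
      ... | no  z≢w with j , refl ← B.stays B.root (subst (λ x → Adj G x z) (sym B.at-root) xz) z≢w =
        contradiction (two-members⇒2≤n λ root≡j → adj⇒≢ xz (trans (sym B.at-root) (cong B.at root≡j))) size≱2
    ... | yes 2≤size with ℓ , y , ℓ≢root , ℓy , unique ← ih B.size< B.isTree 2≤size B.root =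
      B.at ℓ , B.at y , B.at≢w ℓ , ℓy , only
      where
      only : ∀ {z} → Adj G (B.at ℓ) z → z ≡ B.at y
      only {z} ℓz with z ≟ w
      ... | yes refl = contradiction (B.injective (trans (sym (branch-neighbour (adj-sym ℓz)))
                         (trans (B.branch-at ℓ) (sym B.at-root)))) ℓ≢root
      ... | no  z≢w with j , refl ← B.stays ℓ ℓz z≢w = cong B.at (unique ℓz)

LeafExtension : Graph (suc n) → Set
LeafExtension {n} G = Σ (Graph n) λ T → ∃ λ x → IsSeparatedTree T × addVertex T (single x) ≅ G

leafExtension : {T : Graph m} {x : Fin m} {G : Graph (suc n)} →
  IsSeparatedTree T → addVertex T (single x) ≅ G → LeafExtension G
leafExtension t i with refl ← ↔⇒≡ (_≅_.bijection i) = _ , _ , t , i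

-- Seen from a leaf ℓ, the rest of the tree is a single branch; reassembling it at ℓ is adding a
-- leaf.
remove-leaf : {G : Graph (suc (suc n))} → IsSeparatedTree G → LeafExtension G
remove-leaf tree with ℓ , y , _ , ℓy , unique ← leaf-exists _ tree (s≤s (s≤s z≤n)) 0F =
  leafExtension (Branches.Branch.isTree tree ℓ ℓy) (assembly-≅ (branch-piece ℓy) unique)
  -- `⊤` is a placeholder: only the graph is reassembled here.
  where open Assembly tree ℓ ⊤

tree₂ : {G : Graph 2} → IsSeparatedTree G → P2 ≅ G
tree₂ {G} tree = extend (remove-leaf tree)
  where
  extend : LeafExtension G → P2 ≅ G
  extend (T , 0F , ((_ , irreflexive) , _) , i) =
    ≅-trans (≅-sym K1⁺≅P2) (≅-trans (lift-≅ {T = K1} {T} (idₚ , λ { 0F 0F → sym (irreflexive 0F) }) 0F) i)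

tree₃ : {G : Graph 3} → IsSeparatedTree G → P3 ≅ G
tree₃ {G} tree = extend (remove-leaf tree)
  where
  select : ∀ y → P3 ≅ addVertex P2 (single y)
  select 0F = ≅-sym P2⁺0≅P3
  select 1F = ≅-sym P2⁺1≅P3
  extend : LeafExtension G → P3 ≅ G
  extend (T , x , t , i) = ≅-trans (select _) (≅-trans (≅-sym (lift-≅ (≅-sym (tree₂ t)) x)) i)

tree₄ : {G : Graph 4} → IsSeparatedTree G → P4 ≅ G ⊎ K13 ≅ G
tree₄ {G} tree = extend (remove-leaf tree)
  where
  select : ∀ y → addVertex P3 (single y) ≅ G → P4 ≅ G ⊎ K13 ≅ G
  select 0F i = inj₁ (≅-trans (≅-sym P3⁺0≅P4) i)
  select 1F i = inj₂ (≅-trans (≅-sym P3⁺1≅K13) i)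
  select 2F i = inj₁ (≅-trans (≅-sym P3⁺2≅P4) i)
  extend : LeafExtension G → P4 ≅ G ⊎ K13 ≅ G
  extend (T , x , t , i) = select _ (≅-trans (≅-sym (lift-≅ (≅-sym (tree₃ t)) x)) i)

small-𝓕 : {G : Graph n} → IsSeparatedTree G → 2 ≤ n → n ≤ 4 → 𝓕 n G
small-𝓕 {2} tree _ _ = ≅-𝓕 (tree₂ tree) base-P2
small-𝓕 {3} tree _ _ = ≅-𝓕 (tree₃ tree) base-P3
small-𝓕 {4} tree _ _ = [ (λ i → ≅-𝓕 i base-P4) , (λ i → ≅-𝓕 i base-K13) ]′ (tree₄ tree)
small-𝓕 {0} _ ()
small-𝓕 {1} _ (s≤s ())
small-𝓕 {suc (suc (suc (suc (suc _))))} _ _ (s≤s (s≤s (s≤s (s≤s ()))))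

-- The larger excess comes first; this is the order in which the operations list their trees.
assemble₂ : {T₁ : Graph n₁} {T₂ : Graph n₂} {S₁ : Subset n₁} {S₂ : Subset n₂} →
  𝓕 n₁ T₁ → 𝓕 n₂ T₂ → Tight T₁ S₁ → Tight T₂ S₂ →
  ∀ r₁ r₂ → Excess n₁ S₁ r₁ → Excess n₂ S₂ r₂ → r₂ ≤ r₁ → r₁ + r₂ ≤ 2 →
  (x₁ : Fin n₁) (x₂ : Fin n₂) → x₁ ∈ S₁ → x₂ ∈ S₂ →
  𝓕 (suc (n₁ + n₂)) (addVertex (T₁ ⊕ T₂) (single x₁ ⊎ᵇ single x₂))
assemble₂ {n₁} {n₂} {T₁} {T₂} {S₁} {S₂} f₁ f₂ t₁ t₂ r₁ r₂ e₁ e₂ r₂≤r₁ r≤2 x₁ x₂ x₁∈ x₂∈ =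
  operation r₁ r₂ (excess-mod S₁ r₁ e₁) (excess-mod S₂ r₂ e₂) r₂≤r₁ r≤2
  where
  Result = 𝓕 (suc (n₁ + n₂)) (addVertex (T₁ ⊕ T₂) (single x₁ ⊎ᵇ single x₂))
  m₁ = tight⇒TMin t₁
  m₂ = tight⇒TMin t₂
  enough : 2 ≤ ∣ tabulate (single x₁ ⊎ᵇ single x₂) ∩ (S₁ ++ S₂) ∣
  enough = chosen-two _ (S₁ ++ S₂) (single-pair x₁ x₂ x₁∈ x₂∈)
  by-c : (n₁ % 3 ≡ 0 × n₂ % 3 ≡ 0) ⊎ (n₁ % 3 ≡ 1 × n₂ % 3 ≡ 2) → Result
  by-c c = op-c2 f₁ m₁ f₂ m₂ c S₁ S₂ (tight⇒min t₁) (tight⇒min t₂) x₁ x₂ enough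
  operation : ∀ r₁ r₂ → n₁ % 3 ≡ (2 + r₁) % 3 → n₂ % 3 ≡ (2 + r₂) % 3 → r₂ ≤ r₁ → r₁ + r₂ ≤ 2 → Result
  operation 0 0 c₁ c₂ _ _ =
    op-a f₁ m₁ f₂ m₂ c₁ c₂ S₁ S₂ (tight⇒min t₁) (tight⇒min t₂) x₁ x₂ x₁∈ x₂∈
  operation 1 0 c₁ c₂ _ _ =
    op-b f₁ m₁ f₂ m₂ c₁ c₂ S₁ S₂ (tight⇒min t₁) (tight⇒min t₂) x₁ x₂ x₁∈ x₂∈
  operation 1 1 c₁ c₂ _ _ = by-c (inj₁ (c₁ , c₂))
  operation 2 0 c₁ c₂ _ _ = by-c (inj₂ (c₁ , c₂))
  operation 0 (suc _) _ _ () _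
  operation 1 (suc (suc _)) _ _ (s≤s ()) _
  operation 2 (suc _) _ _ _ (s≤s (s≤s ()))
  operation (suc (suc (suc _))) _ _ _ _ (s≤s (s≤s ()))

-- Decomposing an optimal tree at an unchosen vertex

TightIn𝓕 : ℕ → Set
TightIn𝓕 n = {G : Graph n} {S : Subset n} → Tight G S → 𝓕 n G

module Decompose {G : Graph n} {S : Subset n} (t : Tight G S) (ih : ∀ {m} → m < n → TightIn𝓕 m)
  {w : Fin n} (Sw : lookup S w ≡ false) where
  open Tight t
  open Assembly tree w S

  -- The smallness of the branch set is not known before all branches have been counted.
  record BranchData (x : Fin n) : Set where
    field
      size     : ℕ
      subtree  : Graph size
      chosen   : Subset size
      root     : Fin size
      piece    : Piece (_≡ x) subtree (single root) chosen
      surplus  : ℕ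
      isExcess : Excess size chosen surplus
      isTight  : surplus ≤ 2 → Tight subtree chosen
      size<    : size < n
      root∈    : lookup S x ≡ true → root ∈ chosen

  branchData : ∀ {x} → Adj G w x → BranchData x
  branchData wx = record
      { size = B.size ; subtree = B.subtree ; chosen = R ; root = B.root ; piece = branch-piece wx
      ; surplus = r ; isExcess = e ; size< = B.size< ; root∈ = root-chosen wx
      ; isTight = λ r≤2 → tight B.isTree (doublyDominating⇒2≤n (proj₁ B.isTree) dd B.root) dd (begin
          3 * ∣ R ∣             ≡⟨ e ⟩
          2 * B.size + 2 + r    ≤⟨ +-monoʳ-≤ (2 * B.size + 2) r≤2 ⟩
          2 * B.size + 2 + 2    ≡⟨ +-assoc (2 * B.size) 2 2 ⟩
          2 * B.size + 4        ∎) }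
    where
    open ≤-Reasoning
    module B = Branches.Branch tree w wx
    R = branchSet wx
    dd = branchSet-dominating wx Sw dominating
    difference = m≤n⇒∃[o]m+o≡n (lowerBound _ B.isTree dd B.root)
    r = proj₁ difference
    e : Excess B.size R r
    e = trans (cong (3 *_) (∣p∣≡#lookup R)) (sym (proj₂ difference))

  member : ∀ {x} (b : BranchData x) → BranchData.surplus b ≤ 2 →
    𝓕 (BranchData.size b) (BranchData.subtree b)
  member b r≤2 = ih (BranchData.size< b) (BranchData.isTight b r≤2)

  two-branches : ∀ {x y} → x ≢ y → lookup S x ≡ true → lookup S y ≡ true →
    (∀ {z} → Adj G w z → z ≡ x ⊎ z ≡ y) → (a : BranchData x) (b : BranchData y) →
    BranchData.surplus b ≤ BranchData.surplus a → 𝓕 n G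
  two-branches {x} {y} x≢y Sx Sy only a b b≤a =
    ≅-𝓕 (assembly-≅ whole only) (assemble₂ (member a a≤2) (member b b≤2) (A.isTight a≤2) (B.isTight b≤2)
      A.surplus B.surplus A.isExcess B.isExcess b≤a a+b≤2 A.root B.root (A.root∈ Sx) (B.root∈ Sy))
    where
    module A = BranchData a
    module B = BranchData b
    whole = ⊕-piece A.piece B.piece λ { refl eq → x≢y eq }
    size-eq : suc (A.size + B.size) ≡ n
    size-eq = ↔⇒≡ (assembly whole only)
    regroup : ∀ p q r s → 2 * p + 2 + r + (2 * q + 2 + s) ≡ 2 * (p + q) + 4 + (r + s)
    regroup = solve-∀
    shift : ∀ m → 2 * suc m + 4 ≡ 2 * m + 4 + 2
    shift = solve-∀
    -- The computation of `attach₂` read backwards: the smallness of S now bounds the sum of the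
    -- surpluses.
    a+b≤2 : A.surplus + B.surplus ≤ 2
    a+b≤2 = +-cancelˡ-≤ (2 * (A.size + B.size) + 4) _ _ (begin
      2 * (A.size + B.size) + 4 + (A.surplus + B.surplus)
        ≡⟨ regroup A.size B.size A.surplus B.surplus ⟨
      2 * A.size + 2 + A.surplus + (2 * B.size + 2 + B.surplus)
        ≡⟨ cong₂ _+_ A.isExcess B.isExcess ⟨
      3 * ∣ A.chosen ∣ + 3 * ∣ B.chosen ∣
        ≡⟨ *-distribˡ-+ 3 (∣ A.chosen ∣) (∣ B.chosen ∣) ⟨
      3 * (∣ A.chosen ∣ + ∣ B.chosen ∣)
        ≡⟨ cong (3 *_) (trans (assembly-count whole only Sw) (∣++∣ A.chosen B.chosen)) ⟨
      3 * ∣ S ∣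
        ≤⟨ small ⟩
      2 * n + 4
        ≡⟨ cong (λ m → 2 * m + 4) size-eq ⟨
      2 * suc (A.size + B.size) + 4
        ≡⟨ shift (A.size + B.size) ⟩
      2 * (A.size + B.size) + 4 + 2
        ∎)
      where open ≤-Reasoning
    a≤2 = ≤-trans (m≤m+n A.surplus B.surplus) a+b≤2
    b≤2 = ≤-trans (m≤n+m B.surplus A.surplus) a+b≤2

  three-branches : ∀ {x y z} → x ≢ y → x ≢ z → y ≢ z → Adj G w x → Adj G w y →
    lookup S x ≡ true → lookup S y ≡ true →
    (∀ {v} → Adj G w v → (v ≡ x ⊎ v ≡ y) ⊎ v ≡ z) →
    BranchData x → BranchData y → BranchData z → 𝓕 n G
  three-branches {x} {y} {z} x≢y x≢z y≢z wx wy Sx Sy only a b c =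
    ≅-𝓕 (assembly-≅ whole only)
      (op-c3 (member a a≤2) (tight⇒TMin ta) (member b b≤2) (tight⇒TMin tb) (member c c≤2) (tight⇒TMin tc)
        (mod A.chosen A.isExcess a≡0) (mod B.chosen B.isExcess b≡0) (mod C.chosen C.isExcess c≡0)
        A.chosen B.chosen C.chosen (tight⇒min ta) (tight⇒min tb) (tight⇒min tc)
        A.root B.root C.root (piece-chosen whole only x≢y wx Sx wy Sy))
    where
    module A = BranchData a
    module B = BranchData b
    module C = BranchData c
    whole = ⊕-piece (⊕-piece A.piece B.piece λ { refl eq → x≢y eq }) C.piece
      λ { (inj₁ refl) eq → x≢z eq ; (inj₂ refl) eq → y≢z eq }
    N = A.size + B.size + C.size
    size-eq : suc N ≡ n
    size-eq = ↔⇒≡ (assembly whole only)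
    distribute : ∀ p q r → 3 * (p + q + r) ≡ 3 * p + 3 * q + 3 * r
    distribute = solve-∀
    regroup : ∀ p q o r s t → 2 * p + 2 + r + (2 * q + 2 + s) + (2 * o + 2 + t) ≡ 2 * (p + q + o) + 6 + (r + s + t)
    regroup = solve-∀
    shift : ∀ m → 2 * suc m + 4 ≡ 2 * m + 6 + 0
    shift = solve-∀
    -- Three constants 2 already make up the 6 in 2n + 4 = 2(N + 1) + 4 = 2N + 6, so nothing is left
    -- for the surpluses.
    total≡0 : A.surplus + B.surplus + C.surplus ≡ 0
    total≡0 = n≤0⇒n≡0 (+-cancelˡ-≤ (2 * N + 6) _ _ (begin
      2 * N + 6 + (A.surplus + B.surplus + C.surplus)
        ≡⟨ regroup A.size B.size C.size A.surplus B.surplus C.surplus ⟨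
      2 * A.size + 2 + A.surplus + (2 * B.size + 2 + B.surplus) + (2 * C.size + 2 + C.surplus)
        ≡⟨ cong₂ _+_ (cong₂ _+_ A.isExcess B.isExcess) C.isExcess ⟨
      3 * ∣ A.chosen ∣ + 3 * ∣ B.chosen ∣ + 3 * ∣ C.chosen ∣
        ≡⟨ distribute (∣ A.chosen ∣) (∣ B.chosen ∣) (∣ C.chosen ∣) ⟨
      3 * (∣ A.chosen ∣ + ∣ B.chosen ∣ + ∣ C.chosen ∣)
        ≡⟨ cong (3 *_) (trans (assembly-count whole only Sw) (trans (∣++∣ (A.chosen ++ B.chosen) C.chosen)
             (cong (_+ ∣ C.chosen ∣) (∣++∣ A.chosen B.chosen)))) ⟨
      3 * ∣ S ∣
        ≤⟨ small ⟩
      2 * n + 4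
        ≡⟨ cong (λ m → 2 * m + 4) size-eq ⟨
      2 * suc N + 4
        ≡⟨ shift N ⟩
      2 * N + 6 + 0
        ∎))
      where open ≤-Reasoning
    a+b≡0 = m+n≡0⇒m≡0 (A.surplus + B.surplus) total≡0
    a≡0 = m+n≡0⇒m≡0 A.surplus a+b≡0
    b≡0 = m+n≡0⇒n≡0 A.surplus a+b≡0
    c≡0 = m+n≡0⇒n≡0 (A.surplus + B.surplus) total≡0
    a≤2 = subst (_≤ 2) (sym a≡0) z≤n
    b≤2 = subst (_≤ 2) (sym b≡0) z≤n
    c≤2 = subst (_≤ 2) (sym c≡0) z≤n
    ta = A.isTight a≤2
    tb = B.isTight b≤2
    tc = C.isTight c≤2
    mod : ∀ {k r} (R : Subset k) → Excess k R r → r ≡ 0 → k % 3 ≡ 2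
    mod R e refl = excess-mod R 0 e

  -- Each neighbour adds 2 to the left side of `branch-inequality`, and smallness leaves room for 6.
  degree≤3 : {l : List (Fin n)} → Unique l → All (Adj G w) l → length l ≤ 3
  degree≤3 {l} unique neighbours = *-cancelˡ-≤ 2 (+-cancelˡ-≤ (2 * n) _ _ (begin
    2 * n + 2 * length l      ≤⟨ branch-inequality tree dominating (λ _ → lowerBound _) Sw unique neighbours ⟩
    3 * # (lookup S) + 2      ≡⟨ cong (λ c → 3 * c + 2) (∣p∣≡#lookup S) ⟨
    3 * ∣ S ∣ + 2             ≤⟨ +-monoˡ-≤ 2 small ⟩
    2 * n + 4 + 2             ≡⟨ +-assoc (2 * n) 4 2 ⟩
    2 * n + 6                 ∎))
    where open ≤-Reasoning

  result : 𝓕 n G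
  result with x , y , x≢y , (Sx , wx) , (Sy , wy) ← proj₂ (dominating w) Sw
    with any? (λ z → (G w z Bool.≟ true) ×-dec ¬? (x ≟ z) ×-dec ¬? (y ≟ z))
  ... | yes (z , wz , x≢z , y≢z) =
    three-branches x≢y x≢z y≢z wx wy Sx Sy only (branchData wx) (branchData wy) (branchData wz)
    where
    only : ∀ {v} → Adj G w v → (v ≡ x ⊎ v ≡ y) ⊎ v ≡ z
    only {v} wv with v ≟ x | v ≟ y | v ≟ z
    ... | yes v≡x | _ | _ = inj₁ (inj₁ v≡x)
    ... | _ | yes v≡y | _ = inj₁ (inj₂ v≡y)
    ... | _ | _ | yes v≡z = inj₂ v≡z
    ... | no v≢x | no v≢y | no v≢z = contradiction
      (degree≤3 ((v≢x ∷ v≢y ∷ v≢z ∷ []) ∷ (x≢y ∷ x≢z ∷ []) ∷ (y≢z ∷ []) ∷ [] ∷ []) (wv ∷ wx ∷ wy ∷ wz ∷ []))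
      λ { (s≤s (s≤s (s≤s ()))) }
  ... | no none = case-order (≤-total (BranchData.surplus b) (BranchData.surplus a))
    where
    a = branchData wx
    b = branchData wy
    only : ∀ {v} → Adj G w v → v ≡ x ⊎ v ≡ y
    only {v} wv with v ≟ x | v ≟ y
    ... | yes v≡x | _ = inj₁ v≡x
    ... | _ | yes v≡y = inj₂ v≡y
    ... | no v≢x | no v≢y = contradiction (v , wv , ≢-sym v≢x , ≢-sym v≢y) none
    case-order : _ → 𝓕 n G
    case-order (inj₁ b≤a) = two-branches x≢y Sx Sy only a b b≤a
    case-order (inj₂ a≤b) = two-branches (≢-sym x≢y) Sy Sx (swap ∘ only) b a a≤b

tight⇒𝓕 : ∀ n → TightIn𝓕 n
tight⇒𝓕 = <-rec TightIn𝓕 build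
  where
  build : ∀ n → (∀ {m} → m < n → TightIn𝓕 m) → TightIn𝓕 n
  build n ih {S = S} t with find-outside (lookup S)
  ... | inj₁ (w , Sw) = Decompose.result t ih Sw
  ... | inj₂ all = small-𝓕 (Tight.tree t) (Tight.2≤n t) (+-cancelˡ-≤ (2 * n) _ _ (begin
    2 * n + n        ≡⟨ +-comm (2 * n) n ⟩
    3 * n            ≡⟨ cong (3 *_) (trans (∣p∣≡#lookup S) (trans (#-cong all) (#-true n))) ⟨
    3 * ∣ S ∣        ≤⟨ Tight.small t ⟩
    2 * n + 4        ∎))
    where open ≤-Reasoning

theorem14 : ∀ (n : ℕ) (G : Graph n) → (𝓕 n G → TMin n G) × (TMin n G → 𝓕 n G)
theorem14 n G = 𝓕⇒TMin , λ m → tight⇒𝓕 n (proj₂ (TMin⇒tight m))
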